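{- Let $I^3_4$ be the 3-graph on 4 vertices with no edges and let $H_4$ be the 3-graph on $\{1,2,3,4,5\}$ with edge set $\{123,124,234,135\}$. Then $\pi_{\min}(I^3_4,H_4)=\frac49$.
   Context: A 3-graph is a 3-uniform hypergraph. For a finite family $\mathcal H$ of 3-graphs and an integer $n$, $\mathrm{ex}_{\min}(n;\mathcal H)$ denotes the minimal possible number of edges in an $n$-vertex 3-graph containing no member of $\mathcal H$ as an induced subgraph, and $\pi_{\min}(\mathcal H)=\lim_{n\to\infty}\mathrm{ex}_{\min}(n;\mathcal H)/\binom n3$ (this limit exists). -}

module Defs where

open import Data.Nat using (ℕ; zero; suc; _+_; _≤_)
open import Data.Nat.Combinatorics using (_C_)
open import Data.Fin using (Fin; _<?_)
open import Data.Fin.Patterns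
open import Data.Bool using (Bool; true; false)
open import Data.List using (List; map; concatMap; allFin)
open import Data.Nat.ListAction using (sum)
open import Data.Integer using (+_)
open import Data.Rational using (ℚ; _/_; 0ℚ)
open import Relation.Nullary using (yes; no; ¬_)
open import Relation.Nullary.Decidable using (toWitness)
open import Data.Fin.Properties using (all?)
open import Data.Bool.Properties using () renaming (_≟_ to _≟B_)
open import Data.Unit using (tt)
open import Relation.Binary.PropositionalEquality using (_≡_; _≢_)
open import Data.Product using (Σ; _×_; _,_)

-- A 3-graph on vertex set Fin n: a symmetric indicator of triples.
-- Only triples of pairwise distinct vertices are meaningful.
record ThreeGraph (n : ℕ) : Set where
  field
    edge   : Fin n → Fin n → Fin n → Bool
    sym₁₂  : ∀ a b c → edge a b c ≡ edge b a c
    sym₂₃  : ∀ a b c → edge a b c ≡ edge a c b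
open ThreeGraph public

numEdges : ∀ {n} → ThreeGraph n → ℕ
numEdges {n} G =
  sum (concatMap (λ i → concatMap (λ j → map (λ k → ind i j k) (allFin n)) (allFin n)) (allFin n))
  where
  ind : Fin n → Fin n → Fin n → ℕ
  ind i j k with i <? j | j <? k | edge G i j k
  ... | yes _ | yes _ | true = 1
  ... | _     | _     | _    = 0

InducedSub : ∀ {k n} → ThreeGraph k → ThreeGraph n → Set
InducedSub {k} {n} H G =
  Σ (Fin k → Fin n) λ f →
    (∀ a b → f a ≡ f b → a ≡ b) ×
    (∀ a b c → a ≢ b → b ≢ c → a ≢ c → edge H a b c ≡ edge G (f a) (f b) (f c))

I34 : ThreeGraph 4
I34 = record { edge = λ _ _ _ → false ; sym₁₂ = λ _ _ _ → _≡_.refl ; sym₂₃ = λ _ _ _ → _≡_.refl }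

-- H_4 on {1,..,5} (encoded as 0..4) with edges 123,124,234,135,
-- i.e. {0,1,2},{0,1,3},{1,2,3},{0,2,4}.
-- The edge indicator is defined on sorted triples and extended symmetrically.
private
  sorted : Fin 5 → Fin 5 → Fin 5 → Bool
  sorted 0F 1F 2F = true
  sorted 0F 1F 3F = true
  sorted 1F 2F 3F = true
  sorted 0F 2F 4F = true
  sorted _  _  _  = false

  h4 : Fin 5 → Fin 5 → Fin 5 → Bool
  h4 a b c with a <? b | b <? c | a <? c
  ... | yes _ | yes _ | _     = sorted a b c
  ... | yes _ | no _  | yes _ = sorted a c b
  ... | yes _ | no _  | no _  = sorted c a b
  ... | no _  | yes _ | yes _ = sorted b a c
  ... | no _  | yes _ | no _  = sorted b c a
  ... | no _  | no _  | _     = sorted c b a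


  h4-sym₁₂ : ∀ a b c → h4 a b c ≡ h4 b a c
  h4-sym₁₂ = toWitness {a? = all? λ a → all? λ b → all? λ c → h4 a b c ≟B h4 b a c} tt

  h4-sym₂₃ : ∀ a b c → h4 a b c ≡ h4 a c b
  h4-sym₂₃ = toWitness {a? = all? λ a → all? λ b → all? λ c → h4 a b c ≟B h4 a c b} tt

H4 : ThreeGraph 5
H4 = record { edge = h4 ; sym₁₂ = h4-sym₁₂ ; sym₂₃ = h4-sym₂₃ }

Free : ∀ {n} → ThreeGraph n → Set
Free G = ¬ InducedSub I34 G × ¬ InducedSub H4 G

IsExMin : ℕ → ℕ → Set
IsExMin n m = Σ (ThreeGraph n) (λ G → Free G × numEdges G ≡ m)
            × (∀ (G : ThreeGraph n) → Free G → m ≤ numEdges G)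

density : ℕ → ℕ → ℚ
density n m with n C 3
... | zero  = 0ℚ
... | suc c = (+ m) / suc c

-- Idea: a flag algebra certificate on six vertices. Call a four-vertex set of type A if it spans one edge
-- and of type B if it spans two. For every 6-vertex 3-graph H without induced I₄ and H₄,
--   6264 (9 e(H) − 80) ≥ Σ A(x, y) + Σ B(x, y) + Σ P(xy, zt),
-- where the first two sums run over the sets of type A and B with {x, y} the remaining vertices, and the
-- third over the pairs uv and the splittings of the rest into xy and zt. Here A, B and P are positive
-- semidefinite forms in the isomorphism types of the links of x and y (of the pairs xy and zt) over the
-- fixed vertices, so summing over all 6-tuples of vertices of G makes the right-hand side a sum of squares
-- and leaves edge density at least 80/9/20 = 4/9. Both sides are invariant under permutations, hence the
-- inequality need only be evaluated for the extensions of the 22 five-vertex graphs by a sixth vertex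
-- which, without loss of generality, has maximal degree. Turán's construction attains 4/9.
module Submission where

open import Defs
open import Algebra.Bundles using (CommutativeMonoid)
open import Algebra.Structures using (IsCommutativeMonoid)
import Algebra.Properties.AbelianGroup as AbelianGroupProperties
import Algebra.Properties.CommutativeSemigroup as CommutativeSemigroupProperties
import Algebra.Properties.Semiring.Sum as SemiringSum
open import Data.Bool using (Bool; true; false; _∧_; _∨_; not; if_then_else_; T)
open import Data.Bool.ListAction using (any)
import Data.Bool.Properties as Bool
open import Data.Empty using (⊥)
open import Data.Fin using (Fin; zero; suc)
import Data.Fin as Fin
open import Data.Fin.Patterns using (0F; 1F; 2F; 3F; 4F)
import Data.Fin.Properties as Fin
open import Data.Integer using (+_)
open import Data.Integer as ℤ using (ℤ; -[1+_]; 0ℤ)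
import Data.Integer.Properties as ℤ
open import Data.List using (List; []; _∷_; _++_; map; length; foldr; lookup; allFin; tabulate; concatMap)
open import Data.List.Properties using (++-assoc)
open import Data.List.Relation.Binary.Permutation.Propositional using (_↭_; refl; prep; swap; ↭-trans)
open import Data.List.Relation.Binary.Permutation.Propositional.Properties
  using (shift; ↭-length) renaming (map⁺ to ↭-map⁺)
open import Data.Nat using (ℕ; _≥_)
open import Data.Nat as ℕ using (zero; suc; _≤ᵇ_; _≡ᵇ_)
open import Data.Nat.Combinatorics using (_C_; nCk+nC[k+1]≡[n+1]C[k+1]; nC1≡n)
import Data.Nat.Induction as ℕ
import Data.Nat.ListAction as ListAction
import Data.Nat.ListAction.Properties as ListAction
import Data.Nat.Properties as ℕ
open import Data.Nat.Solver using (module +-*-Solver)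
open import Data.Product using (Σ; ∃; ∃₂; _×_; _,_; proj₁; proj₂)
open import Data.Rational using (ℚ; 0ℚ; _<_; _-_; ∣_∣; _/_)
open import Data.Rational as ℚ using (mkℚ; toℚᵘ; fromℚᵘ)
import Data.Rational.Properties as ℚ
open import Data.Rational.Unnormalised as ℚᵘ using (mkℚᵘ)
import Data.Rational.Unnormalised.Properties as ℚᵘ
open import Data.Sum using (_⊎_; inj₁; inj₂)
open import Data.Unit using (⊤; tt)
open import Function using (_∘_; id)
open import Induction.WellFounded using (Acc; acc)
open import Level using (0ℓ)
open import Relation.Binary.Definitions using (tri<; tri≈; tri>)
open import Relation.Binary.PropositionalEquality hiding ([_])
open import Relation.Nullary using (does; isYes; yes; no; ¬_; contradiction)
open import Relation.Nullary.Decidable using (toWitness; ¬?; _→-dec_; _⊎-dec_; dec-true; dec-false)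

-- Two obstacles shape the proof. A sum of squares needs its two arguments to range independently,
-- which sums over 6-element sets do not allow. The pointwise inequality then holds for every tuple,
-- because each pair of vertices of I₄ and of H₄ lies in a non-edge, so no copy of them can use a
-- vertex twice. The price is at most 3n² ordered triples counted in excess, which disappears in the
-- limit. The other obstacle is size: the inequality is checked by evaluation during type checking,
-- and there are 2^20 labelled graphs on six vertices. Fixing a representative on five of them
-- leaves 22 · 2^10, and the degree condition discards many extensions before the quadratic forms
-- are evaluated. The factor 6264 only fixes the scale of the integer matrices and cancels in
-- `triples-bound`.

private variable
  A B V W : Set

-- Sums over the k-subsets of a list

-- Combines the values ψ p q over all k-subsets p of a list, q being the complement.
choose : {A B : Set} → (B → B → B) → B → (List A → List A → B) → ℕ → List A → B
choose _∙_ ε ψ zero    xs       = ψ [] xs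
choose _∙_ ε ψ (suc k) []       = ε
choose _∙_ ε ψ (suc k) (x ∷ xs) =
  choose _∙_ ε (λ p q → ψ (x ∷ p) q) k xs ∙ choose _∙_ ε (λ p q → ψ p (x ∷ q)) (suc k) xs

module _ {A B : Set} (ε : B) where
  -- The default `ε` serves totality: subsets and complements taken from a list of the intended
  -- length always have the matching length.
  at1 : (A → B) → List A → B
  at1 f (a ∷ []) = f a
  at1 f _ = ε
  at2 : (A → A → B) → List A → B
  at2 f (a ∷ b ∷ []) = f a b
  at2 f _ = ε
  at3 : (A → A → A → B) → List A → B
  at3 f (a ∷ b ∷ c ∷ []) = f a b c
  at3 f _ = ε
  at4 : (A → A → A → A → B) → List A → B
  at4 f (a ∷ b ∷ c ∷ d ∷ []) = f a b c d
  at4 f _ = ε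

nth : {A : Set} → A → List A → ℕ → A
nth d []       _       = d
nth d (x ∷ xs) zero    = x
nth d (x ∷ xs) (suc i) = nth d xs i

-- Indices beyond the table read as zero; the classes 12 of `classA` and 21 of `classB` rely on
-- this.
entry : List (List ℤ) → ℕ → ℕ → ℤ
entry T i j = nth 0ℤ (nth [] T i) j

ind : Bool → ℕ
ind true = 1
ind false = 0

-- The certificate

-- Gram matrices, tabulated because every evaluation of the inequality consults them many times.
tableA : List (List ℤ)
tableA =
    (+ 23430 ∷ -[1+ 12947 ] ∷ + 30372 ∷ -[1+ 10481 ] ∷ -[1+ 251 ] ∷ + 10362 ∷ + 14166 ∷ + 792 ∷ -[1+ 46859 ] ∷ -[1+ 4385 ] ∷ + 0 ∷ -[1+ 5477 ] ∷ [])
  ∷ (-[1+ 12947 ] ∷ + 43062 ∷ + 14472 ∷ -[1+ 30113 ] ∷ -[1+ 19757 ] ∷ -[1+ 7199 ] ∷ -[1+ 28637 ] ∷ + 10296 ∷ + 25896 ∷ -[1+ 7121 ] ∷ + 0 ∷ + 29946 ∷ [])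
  ∷ (+ 30372 ∷ + 14472 ∷ + 67044 ∷ -[1+ 44843 ] ∷ -[1+ 17627 ] ∷ + 12312 ∷ + 870 ∷ + 9888 ∷ -[1+ 60743 ] ∷ -[1+ 13175 ] ∷ + 0 ∷ + 16206 ∷ [])
  ∷ (-[1+ 10481 ] ∷ -[1+ 30113 ] ∷ -[1+ 44843 ] ∷ + 40596 ∷ + 20010 ∷ -[1+ 3161 ] ∷ + 14472 ∷ -[1+ 11087 ] ∷ + 20964 ∷ + 11508 ∷ + 0 ∷ -[1+ 24467 ] ∷ [])
  ∷ (-[1+ 251 ] ∷ -[1+ 19757 ] ∷ -[1+ 17627 ] ∷ + 20010 ∷ + 11109 ∷ + 639 ∷ + 11295 ∷ -[1+ 5831 ] ∷ + 504 ∷ + 5280 ∷ + 0 ∷ -[1+ 14861 ] ∷ [])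
  ∷ (+ 10362 ∷ -[1+ 7199 ] ∷ + 12312 ∷ -[1+ 3161 ] ∷ + 639 ∷ + 4845 ∷ + 7539 ∷ -[1+ 443 ] ∷ -[1+ 20723 ] ∷ -[1+ 1139 ] ∷ + 0 ∷ -[1+ 3605 ] ∷ [])
  ∷ (+ 14166 ∷ -[1+ 28637 ] ∷ + 870 ∷ + 14472 ∷ + 11295 ∷ + 7539 ∷ + 21846 ∷ -[1+ 6887 ] ∷ -[1+ 28331 ] ∷ + 4320 ∷ + 0 ∷ -[1+ 19130 ] ∷ [])
  ∷ (+ 792 ∷ + 10296 ∷ + 9888 ∷ -[1+ 11087 ] ∷ -[1+ 5831 ] ∷ -[1+ 443 ] ∷ -[1+ 6887 ] ∷ + 4548 ∷ -[1+ 1583 ] ∷ -[1+ 4415 ] ∷ + 0 ∷ + 8028 ∷ [])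
  ∷ (-[1+ 46859 ] ∷ + 25896 ∷ -[1+ 60743 ] ∷ + 20964 ∷ + 504 ∷ -[1+ 20723 ] ∷ -[1+ 28331 ] ∷ -[1+ 1583 ] ∷ + 93720 ∷ + 8772 ∷ + 0 ∷ + 10956 ∷ [])
  ∷ (-[1+ 4385 ] ∷ -[1+ 7121 ] ∷ -[1+ 13175 ] ∷ + 11508 ∷ + 5280 ∷ -[1+ 1139 ] ∷ + 4320 ∷ -[1+ 4415 ] ∷ + 8772 ∷ + 5196 ∷ + 0 ∷ -[1+ 6377 ] ∷ [])
  ∷ (+ 0 ∷ + 0 ∷ + 0 ∷ + 0 ∷ + 0 ∷ + 0 ∷ + 0 ∷ + 0 ∷ + 0 ∷ + 0 ∷ + 0 ∷ + 0 ∷ [])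
  ∷ (-[1+ 5477 ] ∷ + 29946 ∷ + 16206 ∷ -[1+ 24467 ] ∷ -[1+ 14861 ] ∷ -[1+ 3605 ] ∷ -[1+ 19130 ] ∷ + 8028 ∷ + 10956 ∷ -[1+ 6377 ] ∷ + 0 ∷ + 21519 ∷ [])
  ∷ []

tableB : List (List ℤ)
tableB =
    (+ 21596 ∷ -[1+ 20967 ] ∷ + 5752 ∷ -[1+ 6135 ] ∷ + 7204 ∷ + 1070 ∷ + 14516 ∷ + 7138 ∷ -[1+ 21653 ] ∷ + 9828 ∷ + 2694 ∷ -[1+ 8131 ] ∷ -[1+ 4847 ] ∷ -[1+ 15983 ] ∷ + 0 ∷ + 316 ∷ + 1984 ∷ + 7008 ∷ + 2910 ∷ -[1+ 1075 ] ∷ -[1+ 2909 ] ∷ [])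
  ∷ (-[1+ 20967 ] ∷ + 36124 ∷ -[1+ 1729 ] ∷ + 7166 ∷ -[1+ 3149 ] ∷ -[1+ 9087 ] ∷ -[1+ 411 ] ∷ -[1+ 34561 ] ∷ + 34974 ∷ -[1+ 16751 ] ∷ -[1+ 1937 ] ∷ + 8388 ∷ + 7548 ∷ + 8558 ∷ -[1+ 41 ] ∷ + 416 ∷ -[1+ 1905 ] ∷ + 6736 ∷ -[1+ 5609 ] ∷ -[1+ 579 ] ∷ + 5610 ∷ [])
  ∷ (+ 5752 ∷ -[1+ 1729 ] ∷ + 44010 ∷ -[1+ 26689 ] ∷ + 40428 ∷ -[1+ 14527 ] ∷ + 8888 ∷ -[1+ 26053 ] ∷ + 17166 ∷ + 11788 ∷ + 4426 ∷ -[1+ 3823 ] ∷ -[1+ 1719 ] ∷ -[1+ 19677 ] ∷ + 0 ∷ -[1+ 16457 ] ∷ -[1+ 11765 ] ∷ -[1+ 11129 ] ∷ + 1074 ∷ -[1+ 537 ] ∷ -[1+ 1073 ] ∷ [])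
  ∷ (-[1+ 6135 ] ∷ + 7166 ∷ -[1+ 26689 ] ∷ + 20132 ∷ -[1+ 24373 ] ∷ + 6596 ∷ + 1814 ∷ + 2878 ∷ -[1+ 4691 ] ∷ -[1+ 10973 ] ∷ -[1+ 1511 ] ∷ + 2872 ∷ + 2196 ∷ + 8442 ∷ -[1+ 83 ] ∷ + 12790 ∷ + 9826 ∷ + 14100 ∷ -[1+ 2195 ] ∷ + 454 ∷ + 2196 ∷ [])
  ∷ (+ 7204 ∷ -[1+ 3149 ] ∷ + 40428 ∷ -[1+ 24373 ] ∷ + 39032 ∷ -[1+ 13651 ] ∷ + 11018 ∷ -[1+ 25399 ] ∷ + 14382 ∷ + 11110 ∷ + 4426 ∷ -[1+ 5087 ] ∷ -[1+ 1719 ] ∷ -[1+ 20911 ] ∷ + 42 ∷ -[1+ 14017 ] ∷ -[1+ 9283 ] ∷ -[1+ 7315 ] ∷ + 1074 ∷ + 42 ∷ -[1+ 1073 ] ∷ [])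
  ∷ (+ 1070 ∷ -[1+ 9087 ] ∷ -[1+ 14527 ] ∷ + 6596 ∷ -[1+ 13651 ] ∷ + 8306 ∷ -[1+ 7689 ] ∷ + 22102 ∷ -[1+ 14411 ] ∷ + 924 ∷ -[1+ 1511 ] ∷ + 142 ∷ -[1+ 1373 ] ∷ + 7770 ∷ + 0 ∷ + 4432 ∷ + 3376 ∷ -[1+ 2417 ] ∷ + 1374 ∷ + 538 ∷ -[1+ 1373 ] ∷ [])
  ∷ (+ 14516 ∷ -[1+ 411 ] ∷ + 8888 ∷ + 1814 ∷ + 11018 ∷ -[1+ 7689 ] ∷ + 35730 ∷ -[1+ 34001 ] ∷ -[1+ 1727 ] ∷ -[1+ 1381 ] ∷ + 5608 ∷ -[1+ 6815 ] ∷ -[1+ 843 ] ∷ -[1+ 26715 ] ∷ -[1+ 83 ] ∷ + 5684 ∷ + 7712 ∷ + 27510 ∷ -[1+ 1739 ] ∷ -[1+ 1159 ] ∷ + 1740 ∷ [])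
  ∷ (+ 7138 ∷ -[1+ 34561 ] ∷ -[1+ 26053 ] ∷ + 2878 ∷ -[1+ 25399 ] ∷ + 22102 ∷ -[1+ 34001 ] ∷ + 75972 ∷ -[1+ 41969 ] ∷ + 12488 ∷ -[1+ 5181 ] ∷ -[1+ 701 ] ∷ -[1+ 6085 ] ∷ + 23500 ∷ + 84 ∷ + 1642 ∷ -[1+ 73 ] ∷ -[1+ 25019 ] ∷ + 6732 ∷ + 1160 ∷ -[1+ 6731 ] ∷ [])
  ∷ (-[1+ 21653 ] ∷ + 34974 ∷ + 17166 ∷ -[1+ 4691 ] ∷ + 14382 ∷ -[1+ 14411 ] ∷ -[1+ 1727 ] ∷ -[1+ 41969 ] ∷ + 43698 ∷ -[1+ 11105 ] ∷ -[1+ 425 ] ∷ + 7518 ∷ + 6930 ∷ + 3216 ∷ + 0 ∷ -[1+ 7325 ] ∷ -[1+ 7637 ] ∷ -[1+ 2489 ] ∷ -[1+ 4991 ] ∷ + 0 ∷ + 4992 ∷ [])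
  ∷ (+ 9828 ∷ -[1+ 16751 ] ∷ + 11788 ∷ -[1+ 10973 ] ∷ + 11110 ∷ + 924 ∷ -[1+ 1381 ] ∷ + 12488 ∷ -[1+ 11105 ] ∷ + 11170 ∷ + 1402 ∷ -[1+ 4095 ] ∷ -[1+ 3759 ] ∷ -[1+ 6279 ] ∷ + 84 ∷ -[1+ 5611 ] ∷ -[1+ 3403 ] ∷ -[1+ 9293 ] ∷ + 3114 ∷ + 84 ∷ -[1+ 3113 ] ∷ [])
  ∷ (+ 2694 ∷ -[1+ 1937 ] ∷ + 4426 ∷ -[1+ 1511 ] ∷ + 4426 ∷ -[1+ 1511 ] ∷ + 5608 ∷ -[1+ 5181 ] ∷ -[1+ 425 ] ∷ + 1402 ∷ + 1402 ∷ -[1+ 1401 ] ∷ -[1+ 645 ] ∷ -[1+ 5607 ] ∷ + 0 ∷ -[1+ 109 ] ∷ + 646 ∷ + 2694 ∷ + 0 ∷ + 0 ∷ + 0 ∷ [])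
  ∷ (-[1+ 8131 ] ∷ + 8388 ∷ -[1+ 3823 ] ∷ + 2872 ∷ -[1+ 5087 ] ∷ + 142 ∷ -[1+ 6815 ] ∷ -[1+ 701 ] ∷ + 7518 ∷ -[1+ 4095 ] ∷ -[1+ 1401 ] ∷ + 3788 ∷ + 1768 ∷ + 7548 ∷ + 0 ∷ -[1+ 75 ] ∷ -[1+ 1287 ] ∷ -[1+ 2995 ] ∷ -[1+ 1121 ] ∷ + 0 ∷ + 1122 ∷ [])
  ∷ (-[1+ 4847 ] ∷ + 7548 ∷ -[1+ 1719 ] ∷ + 2196 ∷ -[1+ 1719 ] ∷ -[1+ 1373 ] ∷ -[1+ 843 ] ∷ -[1+ 6085 ] ∷ + 6930 ∷ -[1+ 3759 ] ∷ -[1+ 645 ] ∷ + 1768 ∷ + 1768 ∷ + 2836 ∷ + 0 ∷ + 428 ∷ -[1+ 27 ] ∷ + 1128 ∷ -[1+ 1121 ] ∷ + 0 ∷ + 1122 ∷ [])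
  ∷ (-[1+ 15983 ] ∷ + 8558 ∷ -[1+ 19677 ] ∷ + 8442 ∷ -[1+ 20911 ] ∷ + 7770 ∷ -[1+ 26715 ] ∷ + 23500 ∷ + 3216 ∷ -[1+ 6279 ] ∷ -[1+ 5607 ] ∷ + 7548 ∷ + 2836 ∷ + 26766 ∷ -[1+ 83 ] ∷ + 810 ∷ -[1+ 2297 ] ∷ -[1+ 14605 ] ∷ -[1+ 251 ] ∷ + 454 ∷ + 252 ∷ [])
  ∷ (+ 0 ∷ -[1+ 41 ] ∷ + 0 ∷ -[1+ 83 ] ∷ + 42 ∷ + 0 ∷ -[1+ 83 ] ∷ + 84 ∷ + 0 ∷ + 84 ∷ + 0 ∷ + 0 ∷ + 0 ∷ -[1+ 83 ] ∷ + 42 ∷ -[1+ 41 ] ∷ + 0 ∷ -[1+ 41 ] ∷ + 0 ∷ + 42 ∷ + 0 ∷ [])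
  ∷ (+ 316 ∷ + 416 ∷ -[1+ 16457 ] ∷ + 12790 ∷ -[1+ 14017 ] ∷ + 4432 ∷ + 5684 ∷ + 1642 ∷ -[1+ 7325 ] ∷ -[1+ 5611 ] ∷ -[1+ 109 ] ∷ -[1+ 75 ] ∷ + 428 ∷ + 810 ∷ -[1+ 41 ] ∷ + 9620 ∷ + 7910 ∷ + 12668 ∷ -[1+ 1073 ] ∷ + 496 ∷ + 1074 ∷ [])
  ∷ (+ 1984 ∷ -[1+ 1905 ] ∷ -[1+ 11765 ] ∷ + 9826 ∷ -[1+ 9283 ] ∷ + 3376 ∷ + 7712 ∷ -[1+ 73 ] ∷ -[1+ 7637 ] ∷ -[1+ 3403 ] ∷ + 646 ∷ -[1+ 1287 ] ∷ -[1+ 27 ] ∷ -[1+ 2297 ] ∷ + 0 ∷ + 7910 ∷ + 7454 ∷ + 11558 ∷ -[1+ 617 ] ∷ + 538 ∷ + 618 ∷ [])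
  ∷ (+ 7008 ∷ + 6736 ∷ -[1+ 11129 ] ∷ + 14100 ∷ -[1+ 7315 ] ∷ -[1+ 2417 ] ∷ + 27510 ∷ -[1+ 25019 ] ∷ -[1+ 2489 ] ∷ -[1+ 9293 ] ∷ + 2694 ∷ -[1+ 2995 ] ∷ + 1128 ∷ -[1+ 14605 ] ∷ -[1+ 41 ] ∷ + 12668 ∷ + 11558 ∷ + 31346 ∷ -[1+ 3065 ] ∷ -[1+ 579 ] ∷ + 3066 ∷ [])
  ∷ (+ 2910 ∷ -[1+ 5609 ] ∷ + 1074 ∷ -[1+ 2195 ] ∷ + 1074 ∷ + 1374 ∷ -[1+ 1739 ] ∷ + 6732 ∷ -[1+ 4991 ] ∷ + 3114 ∷ + 0 ∷ -[1+ 1121 ] ∷ -[1+ 1121 ] ∷ -[1+ 251 ] ∷ + 0 ∷ -[1+ 1073 ] ∷ -[1+ 617 ] ∷ -[1+ 3065 ] ∷ + 1122 ∷ + 0 ∷ -[1+ 1121 ] ∷ [])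
  ∷ (-[1+ 1075 ] ∷ -[1+ 579 ] ∷ -[1+ 537 ] ∷ + 454 ∷ + 42 ∷ + 538 ∷ -[1+ 1159 ] ∷ + 1160 ∷ + 0 ∷ + 84 ∷ + 0 ∷ + 0 ∷ + 0 ∷ + 454 ∷ + 42 ∷ + 496 ∷ + 538 ∷ -[1+ 579 ] ∷ + 0 ∷ + 580 ∷ + 0 ∷ [])
  ∷ (-[1+ 2909 ] ∷ + 5610 ∷ -[1+ 1073 ] ∷ + 2196 ∷ -[1+ 1073 ] ∷ -[1+ 1373 ] ∷ + 1740 ∷ -[1+ 6731 ] ∷ + 4992 ∷ -[1+ 3113 ] ∷ + 0 ∷ + 1122 ∷ + 1122 ∷ + 252 ∷ + 0 ∷ + 1074 ∷ + 618 ∷ + 3066 ∷ -[1+ 1121 ] ∷ + 0 ∷ + 1122 ∷ [])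
  ∷ []

tableP : List (List ℤ)
tableP =
    (+ 0 ∷ + 0 ∷ + 0 ∷ + 0 ∷ + 0 ∷ + 0 ∷ + 0 ∷ + 0 ∷ + 0 ∷ [])
  ∷ (+ 0 ∷ + 1822 ∷ + 3864 ∷ -[1+ 305 ] ∷ + 340 ∷ -[1+ 1831 ] ∷ -[1+ 1851 ] ∷ -[1+ 1353 ] ∷ -[1+ 3099 ] ∷ [])
  ∷ (+ 0 ∷ + 3864 ∷ + 9918 ∷ -[1+ 571 ] ∷ + 826 ∷ -[1+ 4923 ] ∷ -[1+ 4097 ] ∷ -[1+ 3069 ] ∷ -[1+ 7091 ] ∷ [])
  ∷ (+ 0 ∷ -[1+ 305 ] ∷ -[1+ 571 ] ∷ + 478 ∷ -[1+ 499 ] ∷ -[1+ 1559 ] ∷ + 2696 ∷ + 706 ∷ -[1+ 299 ] ∷ [])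
  ∷ (+ 0 ∷ + 340 ∷ + 826 ∷ -[1+ 499 ] ∷ + 550 ∷ + 1470 ∷ -[1+ 2845 ] ∷ -[1+ 767 ] ∷ + 220 ∷ [])
  ∷ (+ 0 ∷ -[1+ 1831 ] ∷ -[1+ 4923 ] ∷ -[1+ 1559 ] ∷ + 1470 ∷ + 10852 ∷ -[1+ 8639 ] ∷ -[1+ 721 ] ∷ + 6964 ∷ [])
  ∷ (+ 0 ∷ -[1+ 1851 ] ∷ -[1+ 4097 ] ∷ + 2696 ∷ -[1+ 2845 ] ∷ -[1+ 8639 ] ∷ + 15670 ∷ + 4226 ∷ -[1+ 1387 ] ∷ [])
  ∷ (+ 0 ∷ -[1+ 1353 ] ∷ -[1+ 3069 ] ∷ + 706 ∷ -[1+ 767 ] ∷ -[1+ 721 ] ∷ + 4226 ∷ + 1678 ∷ + 1420 ∷ [])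
  ∷ (+ 0 ∷ -[1+ 3099 ] ∷ -[1+ 7091 ] ∷ -[1+ 299 ] ∷ + 220 ∷ + 6964 ∷ -[1+ 1387 ] ∷ + 1420 ∷ + 6960 ∷ [])
  ∷ []

-- Representatives of the 22 isomorphism classes of five-vertex graphs without induced I₄ and H₄.
reps : List ℕ
reps = 75 ∷ 76 ∷ 79 ∷ 86 ∷ 87 ∷ 94 ∷ 95 ∷ 116 ∷ 117 ∷ 119 ∷ 127 ∷ 222 ∷ 223 ∷ 235 ∷ 236 ∷ 237 ∷ 239 ∷ 254 ∷ 255 ∷ 507 ∷ 511 ∷ 1023 ∷ []

Bool⁶→ : Set → Set
Bool⁶→ A = Bool → Bool → Bool → Bool → Bool → Bool → A

-- The arguments are the bits of the link of x over a, b, c, d, where abc is the only edge of abcd;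
-- the classes are the orbits under permutations of a, b, c, and 12 stands for links forcing an I₄ or H₄.
classA : Bool⁶→ ℕ
classA ab ac bc ad bd cd =
  pick (ind ab ℕ.+ ind ac ℕ.+ ind bc) (ind ad ℕ.+ ind bd ℕ.+ ind cd)
  where
  pick : ℕ → ℕ → ℕ
  pick 3 0 = 0
  pick 1 1 = 1
  pick 3 1 = 2
  pick 0 2 = 3
  pick 1 2 = 4
  -- In class 5 the two absent pairs share a vertex, in class 6 they are disjoint. For all other
  -- counts at most one orbit avoids both I₄ and H₄, so counting suffices.
  pick 2 2 = if (ab ∧ not cd) ∨ (ac ∧ not bd) ∨ (bc ∧ not ad) then 5 else 6
  pick 3 2 = 7
  pick 0 3 = 8
  pick 1 3 = 9
  pick 2 3 = 10
  pick 3 3 = 11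
  pick _ _ = 12

-- The same for abcd with the edges abc and abd, up to exchanging a, b and exchanging c, d.
classB : Bool⁶→ ℕ
classB ab ac bc ad bd cd = pick cd ab (ind ac ℕ.+ ind bc ℕ.+ ind ad ℕ.+ ind bd)
  where
  split : ℕ → ℕ → ℕ → ℕ
  -- Exactly two of `ac`, `bc`, `ad`, `bd` hold where this is used: they share one of the vertices
  -- a, b (first value), share one of c, d (second), or are disjoint (third).
  split r c d = if (ac ∧ ad) ∨ (bc ∧ bd) then r else if (ac ∧ bc) ∨ (ad ∧ bd) then c else d
  pick : Bool → Bool → ℕ → ℕ
  pick false false 2 = split 21 21 1
  pick false false 3 = 3
  pick false false 4 = 5
  pick false true  2 = split 21 0 2
  pick false true  3 = 4
  pick false true  4 = 6
  pick true  false 0 = 7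
  pick true  false 1 = 9
  pick true  false 2 = split 13 11 15
  pick true  false 3 = 17
  pick true  false 4 = 19
  pick true  true  0 = 8
  pick true  true  1 = 10
  pick true  true  2 = split 14 12 16
  pick true  true  3 = 18
  pick true  true  4 = 20
  pick _     _     _ = 21

oneEdge twoEdges : Bool → Bool → Bool → Bool → ℤ → ℤ
oneEdge  abc abd acd bcd v = if abc ∧ not (abd ∨ acd ∨ bcd) then v else 0ℤ
twoEdges abc abd acd bcd v = if abc ∧ abd ∧ not (acd ∨ bcd) then v else 0ℤ

exactlyOne : Bool → Bool → Bool → Bool
exactlyOne true  p q = not (p ∨ q)
exactlyOne false true  q = not q
exactlyOne false false q = q

module Graph {V : Set} (E : V → V → V → Bool) where

  edges : List V → ℕ
  edges = choose ℕ._+_ 0 (λ p _ → at3 0 (λ a b c → ind (E a b c)) p) 3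

  -- 6264 times 9 [edge] − 4.
  cost : Bool → ℤ
  cost true  = + 31320
  cost false = -[1+ 25055 ]

  costAt costSum : List V → ℤ
  costAt  = at3 0ℤ (λ a b c → cost (E a b c))
  costSum = choose ℤ._+_ 0ℤ (λ p _ → costAt p) 3

  link : Bool⁶→ ℕ → V → V → V → V → V → ℕ
  link κ a b c d x = κ (E a b x) (E a c x) (E b c x) (E a d x) (E b d x) (E c d x)

  leafA leafB : V → V → V → V → List V → ℤ
  leafA a b c d q = oneEdge (E a b c) (E a b d) (E a c d) (E b c d)
    (at2 0ℤ (λ x y → entry tableA (link classA a b c d x) (link classA a b c d y)) q)
  leafB a b c d q = twoEdges (E a b c) (E a b d) (E a c d) (E b c d)
    (at2 0ℤ (λ x y → entry tableB (link classB a b c d x) (link classB a b c d y)) q)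

  termA termB : List V → List V → List V → ℤ
  termA abc d q = at3 0ℤ (λ a b c → at1 0ℤ (λ d → leafA a b c d q) d) abc
  termB ab cd q = at2 0ℤ (λ a b → at2 0ℤ (λ c d → leafB a b c d q) cd) ab

  -- On a four-vertex set at most one splitting contributes: the one given by its single edge, or by
  -- the pair common to its two edges. Summing over all splittings labels the set without a choice.
  splitType : List V → List V → ℤ
  splitType p q = choose ℤ._+_ 0ℤ (λ abc d → termA abc d q) 3 p
            ℤ.+ choose ℤ._+_ 0ℤ (λ ab cd → termB ab cd q) 2 p

  types : List V → ℤ
  types = choose ℤ._+_ 0ℤ splitType 4

  -- Exchanging `x`, `y` permutes the first two edges and exchanging `u`, `v` the last two, so two
  -- counts from 0 to 2, read as base 3 digits, name the isomorphism type.
  linkP : V → V → V → V → ℕ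
  linkP u v x y = ind (E u v x) ℕ.+ ind (E u v y) ℕ.+ 3 ℕ.* (ind (E u x y) ℕ.+ ind (E v x y))

  termP : List V → List V → List V → ℤ
  termP uv xy zt = at2 0ℤ (λ u v → at2 0ℤ (λ x y → at2 0ℤ (λ z t →
    entry tableP (linkP u v x y) (linkP u v z t)) zt) xy) uv

  splitPair : List V → List V → ℤ
  splitPair uv = choose ℤ._+_ 0ℤ (termP uv) 2

  pairs : List V → ℤ
  pairs = choose ℤ._+_ 0ℤ splitPair 2

  noI4 : List V → Bool
  noI4 = choose _∧_ true (λ p _ → at4 true (λ a b c d → E a b c ∨ E a b d ∨ E a c d ∨ E b c d) p) 4

  -- H₄ consists of the three edges through c in abcd, for which abd is no edge, and exactly one edge
  -- joining a fifth vertex x to abcd, which avoids c.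
  h4Free : V → V → V → V → V → Bool
  h4Free c a b d x = E c a x ∨ E c b x ∨ E c d x ∨ not (exactlyOne (E a b x) (E a d x) (E b d x))

  noH4At : List V → List V → List V → Bool
  noH4At c abd q = at1 true (λ c → at3 true (λ a b d →
    if E c a b ∧ E c a d ∧ E c b d ∧ not (E a b d)
    then choose _∧_ true (λ x _ → at1 true (h4Free c a b d) x) 1 q else true) abd) c

  noH4 : List V → Bool
  noH4 = choose _∧_ true (λ p q → choose _∧_ true (λ c abd → noH4At c abd q) 1 p) 4

  -- Deleting a vertex lowers the edge count by its degree, so with `e` the edge count of the tail
  -- this says that the head has maximal degree.
  minimal : ℕ → List V → Bool
  minimal e = choose _∧_ true (λ _ r → e ≤ᵇ edges r) 1

  -- A binary number with one bit per triple, the first triple of `choose` being the lowest bit;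
  -- `reps` is written in this code.
  code : List V → ℕ
  code l = foldr (λ b m → ind b ℕ.+ 2 ℕ.* m) 0
    (choose _++_ [] (λ p _ → at3 [] (λ a b c → E a b c ∷ []) p) 3 l)

  isRep : List V → Bool
  isRep l = any (code l ≡ᵇ_) reps

-- S1 n, S2 n and S3 n encode the sets of 1-, 2- and 3-subsets of Fin n, so that all of them can be
-- enumerated; vertex 0 of S3 (suc n) comes with its link in S2 n. Triples with coinciding vertices
-- count as edges.
S1 S2 S3 : ℕ → Set
S1 zero = ⊤
S1 (suc n) = Bool × S1 n
S2 zero = ⊤
S2 (suc n) = S1 n × S2 n
S3 zero = ⊤
S3 (suc n) = S2 n × S3 n

E1 : ∀ {n} → S1 n → Fin n → Bool
E1 (b , s) zero = b
E1 (b , s) (suc i) = E1 s i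
E2 : ∀ {n} → S2 n → Fin n → Fin n → Bool
E2 (s , r) zero zero = true
E2 (s , r) zero (suc j) = E1 s j
E2 (s , r) (suc i) zero = E1 s i
E2 (s , r) (suc i) (suc j) = E2 r i j
E3 : ∀ {n} → S3 n → Fin n → Fin n → Fin n → Bool
E3 (s , r) zero zero k = true
E3 (s , r) zero (suc j) zero = true
E3 (s , r) zero (suc j) (suc k) = E2 s j k
E3 (s , r) (suc i) zero zero = true
E3 (s , r) (suc i) zero (suc k) = E2 s i k
E3 (s , r) (suc i) (suc j) zero = E2 s i j
E3 (s , r) (suc i) (suc j) (suc k) = E3 r i j k

all1 : ∀ n → (S1 n → Bool) → Bool
all1 zero P = P tt
all1 (suc n) P = all1 n (λ s → P (false , s)) ∧ all1 n (λ s → P (true , s))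
all2 : ∀ n → (S2 n → Bool) → Bool
all2 zero P = P tt
all2 (suc n) P = all1 n λ s → all2 n λ r → P (s , r)
all3 : ∀ n → (S3 n → Bool) → Bool
all3 zero P = P tt
all3 (suc n) P = all2 n λ s → all3 n λ r → P (s , r)

anyInsert : {A : Set} → (List A → Bool) → A → List A → Bool
anyInsert P x []       = P (x ∷ [])
anyInsert P x (y ∷ ys) = P (x ∷ y ∷ ys) ∨ anyInsert (λ zs → P (y ∷ zs)) x ys

anyPerm : {A : Set} → (List A → Bool) → List A → Bool
anyPerm P []       = P []
anyPerm P (x ∷ xs) = anyPerm (anyInsert P x) xs

-- Invariance under permutations

choose-cong : ∀ {_∙_ : B → B → B} {ε} {ψ φ : List V → List V → B} →
  (∀ p q → ψ p q ≡ φ p q) → ∀ k l → choose _∙_ ε ψ k l ≡ choose _∙_ ε φ k l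
choose-cong h zero    l       = h [] l
choose-cong h (suc k) []      = refl
choose-cong {_∙_ = _∙_} h (suc k) (x ∷ l) =
  cong₂ _∙_ (choose-cong (λ p q → h (x ∷ p) q) k l) (choose-cong (λ p q → h p (x ∷ q)) (suc k) l)

choose-map : ∀ {_∙_ : B → B → B} {ε} {ψ : List V → List V → B} {φ : List W → List W → B} (f : W → V) →
  (∀ p q → ψ (map f p) (map f q) ≡ φ p q) → ∀ k l → choose _∙_ ε ψ k (map f l) ≡ choose _∙_ ε φ k l
choose-map f h zero    l       = h [] l
choose-map f h (suc k) []      = refl
choose-map {_∙_ = _∙_} f h (suc k) (x ∷ l) =
  cong₂ _∙_ (choose-map f (λ p q → h (x ∷ p) q) k l) (choose-map f (λ p q → h p (x ∷ q)) (suc k) l)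

Invariant : (List V → B) → Set
Invariant F = ∀ {l l′} → l ↭ l′ → F l ≡ F l′

module _ {_∙_ : B → B → B} {ε : B} (M : IsCommutativeMonoid _≡_ _∙_ ε) where

  private
    commutativeMonoid : CommutativeMonoid 0ℓ 0ℓ
    commutativeMonoid = record { isCommutativeMonoid = M }
    open CommutativeSemigroupProperties (CommutativeMonoid.commutativeSemigroup commutativeMonoid)
      using (x∙yz≈y∙xz; interchange)
    open ≡-Reasoning

  -- A swap of two neighbours preserves the subsets containing both or neither and exchanges those
  -- containing just one, so the terms are only rearranged.
  choose-invariant : {ψ : List V → List V → B} →
    (∀ q → Invariant (λ p → ψ p q)) → (∀ p → Invariant (ψ p)) → ∀ k → Invariant (choose _∙_ ε ψ k)
  choose-invariant i₁ i₂ zero    h = i₂ [] h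
  choose-invariant i₁ i₂ (suc k) refl = refl
  choose-invariant i₁ i₂ (suc k) (prep x h) = cong₂ _∙_
    (choose-invariant (λ q g → i₁ q (prep x g)) (λ p → i₂ (x ∷ p)) k h)
    (choose-invariant (λ q → i₁ (x ∷ q)) (λ p g → i₂ p (prep x g)) (suc k) h)
  -- A 1-subset cannot contain both neighbours, which leaves three terms instead of four.
  choose-invariant i₁ i₂ (suc zero) (swap {xs = l} x y h) = begin
    _ ≡⟨ cong₂ _∙_ (i₂ (x ∷ []) (prep y h)) (cong₂ _∙_ (i₂ (y ∷ []) (prep x h))
           (trans (choose-cong (λ p q → i₂ p (swap x y (refl {xs = q}))) 1 l)
                  (choose-invariant (λ q → i₁ (y ∷ x ∷ q)) (λ p g → i₂ p (prep y (prep x g))) 1 h))) ⟩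
    _ ≡⟨ x∙yz≈y∙xz _ _ _ ⟩
    _ ∎
  choose-invariant i₁ i₂ (suc (suc k)) (swap {xs = l} x y h) = begin
    _ ≡⟨ cong₂ _∙_
      (cong₂ _∙_
        (trans (choose-cong (λ p q → i₁ q (swap x y refl)) k _)
               (choose-invariant (λ q g → i₁ q (prep y (prep x g))) (λ p → i₂ (y ∷ x ∷ p)) k h))
        (choose-invariant (λ q g → i₁ (y ∷ q) (prep x g)) (λ p g → i₂ (x ∷ p) (prep y g)) (suc k) h))
      (cong₂ _∙_
        (choose-invariant (λ q g → i₁ (x ∷ q) (prep y g)) (λ p g → i₂ (y ∷ p) (prep x g)) (suc k) h)
        (trans (choose-cong (λ p q → i₂ p (swap x y (refl {xs = q}))) (suc (suc k)) l)
               (choose-invariant (λ q → i₁ (y ∷ x ∷ q)) (λ p g → i₂ p (prep y (prep x g))) (suc (suc k)) h))) ⟩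
    _ ≡⟨ interchange _ _ _ _ ⟩
    _ ∎
  choose-invariant i₁ i₂ (suc k) (_↭_.trans g h) =
    trans (choose-invariant i₁ i₂ (suc k) g) (choose-invariant i₁ i₂ (suc k) h)

-- `prep` acts below a fixed head, so the induction on the permutation carries the prefix `w`
-- already passed.
swap⇒invariant : {F : List V → B} →
  (∀ w x y l → F (w ++ x ∷ y ∷ l) ≡ F (w ++ y ∷ x ∷ l)) → Invariant F
swap⇒invariant {F = F} s = go []
  where
  push : ∀ w x {l l′} → F ((w ++ x ∷ []) ++ l) ≡ F ((w ++ x ∷ []) ++ l′) → F (w ++ x ∷ l) ≡ F (w ++ x ∷ l′)
  push w x {l} {l′} e = trans (cong F (sym (++-assoc w (x ∷ []) l))) (trans e (cong F (++-assoc w (x ∷ []) l′)))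
  go : ∀ w {l l′} → l ↭ l′ → F (w ++ l) ≡ F (w ++ l′)
  go w refl         = refl
  go w (prep x h)   = push w x (go (w ++ x ∷ []) h)
  go w (swap x y h) = trans (s w x y _) (push w y (push (w ++ y ∷ []) x (go ((w ++ y ∷ []) ++ x ∷ []) h)))
  go w (_↭_.trans g h)  = trans (go w g) (go w h)

module _ {ε : B} where

  at1-cong : {f g : V → B} → (∀ a → f a ≡ g a) → ∀ l → at1 ε f l ≡ at1 ε g l
  at1-cong h []          = refl
  at1-cong h (a ∷ [])    = h a
  at1-cong h (_ ∷ _ ∷ _) = refl

  at2-cong : {f g : V → V → B} → (∀ a b → f a b ≡ g a b) → ∀ l → at2 ε f l ≡ at2 ε g l
  at2-cong h []              = refl
  at2-cong h (_ ∷ [])        = refl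
  at2-cong h (a ∷ b ∷ [])    = h a b
  at2-cong h (_ ∷ _ ∷ _ ∷ _) = refl

  at3-cong : {f g : V → V → V → B} → (∀ a b c → f a b c ≡ g a b c) → ∀ l → at3 ε f l ≡ at3 ε g l
  at3-cong h []                  = refl
  at3-cong h (_ ∷ [])            = refl
  at3-cong h (_ ∷ _ ∷ [])        = refl
  at3-cong h (a ∷ b ∷ c ∷ [])    = h a b c
  at3-cong h (_ ∷ _ ∷ _ ∷ _ ∷ _) = refl

  at1-map : (f : W → V) {g : V → B} {h : W → B} → (∀ a → g (f a) ≡ h a) → ∀ l → at1 ε g (map f l) ≡ at1 ε h l
  at1-map f e []          = refl
  at1-map f e (a ∷ [])    = e a
  at1-map f e (_ ∷ _ ∷ _) = refl

  at2-map : (f : W → V) {g : V → V → B} {h : W → W → B} → (∀ a b → g (f a) (f b) ≡ h a b) →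
    ∀ l → at2 ε g (map f l) ≡ at2 ε h l
  at2-map f e []              = refl
  at2-map f e (_ ∷ [])        = refl
  at2-map f e (a ∷ b ∷ [])    = e a b
  at2-map f e (_ ∷ _ ∷ _ ∷ _) = refl

  at3-map : (f : W → V) {g : V → V → V → B} {h : W → W → W → B} → (∀ a b c → g (f a) (f b) (f c) ≡ h a b c) →
    ∀ l → at3 ε g (map f l) ≡ at3 ε h l
  at3-map f e []                  = refl
  at3-map f e (_ ∷ [])            = refl
  at3-map f e (_ ∷ _ ∷ [])        = refl
  at3-map f e (a ∷ b ∷ c ∷ [])    = e a b c
  at3-map f e (_ ∷ _ ∷ _ ∷ _ ∷ _) = refl

  at1-invariant : {g : V → B} → Invariant (at1 ε g)
  at1-invariant = swap⇒invariant λ where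
    []          _ _ _ → refl
    (_ ∷ [])    _ _ _ → refl
    (_ ∷ _ ∷ _) _ _ _ → refl

  at2-invariant : {g : V → V → B} → (∀ a b → g a b ≡ g b a) → Invariant (at2 ε g)
  at2-invariant s = swap⇒invariant λ where
    []              a b []      → s a b
    []              _ _ (_ ∷ _) → refl
    (_ ∷ [])        _ _ _       → refl
    (_ ∷ _ ∷ [])    _ _ _       → refl
    (_ ∷ _ ∷ _ ∷ _) _ _ _       → refl

  at3-invariant : {g : V → V → V → B} → (∀ a b c → g a b c ≡ g b a c) → (∀ a b c → g a b c ≡ g a c b) →
    Invariant (at3 ε g)
  at3-invariant s₁₂ s₂₃ = swap⇒invariant λ where
    []                  _ _ []          → refl
    []                  a b (c ∷ [])    → s₁₂ a b c
    []                  _ _ (_ ∷ _ ∷ _) → refl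
    (a ∷ [])            b c []          → s₂₃ a b c
    (_ ∷ [])            _ _ (_ ∷ _)     → refl
    (_ ∷ _ ∷ [])        _ _ _           → refl
    (_ ∷ _ ∷ _ ∷ [])    _ _ _           → refl
    (_ ∷ _ ∷ _ ∷ _ ∷ _) _ _ _           → refl

-- The forms Σₖ cₖ wₖ(i) wₖ(j) with coefficients cₖ and with wₖ(i) in column k and row i of the values,
-- found numerically by semidefinite programming and column generation, then rounded.
coeffsA : List ℕ
coeffsA = 486 ∷ 45 ∷ 876 ∷ 453 ∷ 186 ∷ 240 ∷ 60 ∷ []

valuesA : List (List ℤ)
valuesA =
    (+ 4 ∷ + 2 ∷ + 1 ∷ + 4 ∷ + 5 ∷ + 3 ∷ + 3 ∷ [])
  ∷ (-[1+ 0 ] ∷ + 0 ∷ + 5 ∷ -[1+ 1 ] ∷ -[1+ 7 ] ∷ -[1+ 4 ] ∷ -[1+ 3 ] ∷ [])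
  ∷ (+ 6 ∷ + 4 ∷ + 6 ∷ + 6 ∷ + 2 ∷ + 0 ∷ + 2 ∷ [])
  ∷ (-[1+ 2 ] ∷ -[1+ 1 ] ∷ -[1+ 5 ] ∷ -[1+ 1 ] ∷ + 3 ∷ + 2 ∷ + 1 ∷ [])
  ∷ (-[1+ 0 ] ∷ -[1+ 0 ] ∷ -[1+ 2 ] ∷ + 0 ∷ + 3 ∷ + 2 ∷ + 1 ∷ [])
  ∷ (+ 2 ∷ + 1 ∷ + 0 ∷ + 2 ∷ + 2 ∷ + 1 ∷ + 1 ∷ [])
  ∷ (+ 2 ∷ + 1 ∷ -[1+ 2 ] ∷ + 3 ∷ + 6 ∷ + 2 ∷ + 2 ∷ [])
  ∷ (+ 0 ∷ + 0 ∷ + 2 ∷ + 0 ∷ -[1+ 1 ] ∷ + 1 ∷ + 1 ∷ [])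
  ∷ (-[1+ 7 ] ∷ -[1+ 3 ] ∷ -[1+ 1 ] ∷ -[1+ 7 ] ∷ -[1+ 9 ] ∷ -[1+ 5 ] ∷ -[1+ 5 ] ∷ [])
  ∷ (-[1+ 0 ] ∷ + 0 ∷ -[1+ 1 ] ∷ + 0 ∷ + 1 ∷ -[1+ 1 ] ∷ -[1+ 0 ] ∷ [])
  ∷ (+ 0 ∷ + 0 ∷ + 0 ∷ + 0 ∷ + 0 ∷ + 0 ∷ + 0 ∷ [])
  ∷ (+ 0 ∷ + 0 ∷ + 4 ∷ -[1+ 0 ] ∷ -[1+ 4 ] ∷ -[1+ 2 ] ∷ -[1+ 1 ] ∷ [])
  ∷ []

coeffsB : List ℕ
coeffsB = 342 ∷ 414 ∷ 420 ∷ 756 ∷ 646 ∷ 252 ∷ 456 ∷ 538 ∷ 844 ∷ 42 ∷ []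

valuesB : List (List ℤ)
valuesB =
    (+ 0 ∷ + 3 ∷ + 2 ∷ + 1 ∷ + 3 ∷ + 3 ∷ + 2 ∷ + 2 ∷ + 2 ∷ + 0 ∷ [])
  ∷ (+ 0 ∷ -[1+ 4 ] ∷ -[1+ 1 ] ∷ + 0 ∷ -[1+ 2 ] ∷ -[1+ 4 ] ∷ -[1+ 4 ] ∷ + 1 ∷ + 0 ∷ + 1 ∷ [])
  ∷ (+ 4 ∷ + 1 ∷ -[1+ 5 ] ∷ + 5 ∷ + 1 ∷ -[1+ 0 ] ∷ + 2 ∷ + 1 ∷ + 1 ∷ + 0 ∷ [])
  ∷ (-[1+ 2 ] ∷ -[1+ 1 ] ∷ + 4 ∷ -[1+ 1 ] ∷ + 0 ∷ + 0 ∷ -[1+ 2 ] ∷ -[1+ 0 ] ∷ -[1+ 0 ] ∷ + 2 ∷ [])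
  ∷ (+ 3 ∷ + 1 ∷ -[1+ 4 ] ∷ + 5 ∷ + 1 ∷ -[1+ 0 ] ∷ + 2 ∷ + 0 ∷ + 2 ∷ -[1+ 0 ] ∷ [])
  ∷ (-[1+ 0 ] ∷ + 1 ∷ + 2 ∷ -[1+ 1 ] ∷ + 0 ∷ + 2 ∷ + 1 ∷ -[1+ 0 ] ∷ -[1+ 0 ] ∷ + 0 ∷ [])
  ∷ (-[1+ 0 ] ∷ -[1+ 1 ] ∷ + 3 ∷ + 4 ∷ + 4 ∷ + 0 ∷ -[1+ 1 ] ∷ + 2 ∷ + 2 ∷ + 2 ∷ [])
  ∷ (-[1+ 0 ] ∷ + 6 ∷ + 2 ∷ -[1+ 5 ] ∷ -[1+ 0 ] ∷ + 6 ∷ + 6 ∷ -[1+ 1 ] ∷ -[1+ 1 ] ∷ -[1+ 1 ] ∷ [])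
  ∷ (+ 2 ∷ -[1+ 3 ] ∷ -[1+ 4 ] ∷ + 2 ∷ -[1+ 2 ] ∷ -[1+ 5 ] ∷ -[1+ 3 ] ∷ + 0 ∷ + 0 ∷ + 0 ∷ [])
  ∷ (+ 1 ∷ + 3 ∷ -[1+ 0 ] ∷ + 1 ∷ + 1 ∷ + 2 ∷ + 3 ∷ + 0 ∷ + 0 ∷ -[1+ 1 ] ∷ [])
  ∷ (+ 0 ∷ + 0 ∷ + 0 ∷ + 1 ∷ + 1 ∷ + 0 ∷ + 0 ∷ + 0 ∷ + 0 ∷ + 0 ∷ [])
  ∷ (+ 0 ∷ -[1+ 0 ] ∷ -[1+ 0 ] ∷ -[1+ 0 ] ∷ -[1+ 0 ] ∷ -[1+ 0 ] ∷ -[1+ 0 ] ∷ + 0 ∷ -[1+ 0 ] ∷ + 0 ∷ [])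
  ∷ (+ 0 ∷ -[1+ 0 ] ∷ + 0 ∷ + 0 ∷ -[1+ 0 ] ∷ -[1+ 0 ] ∷ -[1+ 0 ] ∷ + 0 ∷ + 0 ∷ + 0 ∷ [])
  ∷ (+ 0 ∷ + 0 ∷ + 0 ∷ -[1+ 3 ] ∷ -[1+ 3 ] ∷ -[1+ 0 ] ∷ + 0 ∷ -[1+ 0 ] ∷ -[1+ 1 ] ∷ + 2 ∷ [])
  ∷ (+ 0 ∷ + 0 ∷ + 0 ∷ + 0 ∷ + 0 ∷ + 0 ∷ + 0 ∷ + 0 ∷ + 0 ∷ -[1+ 0 ] ∷ [])
  ∷ (-[1+ 1 ] ∷ -[1+ 0 ] ∷ + 3 ∷ -[1+ 0 ] ∷ + 1 ∷ + 1 ∷ -[1+ 1 ] ∷ -[1+ 0 ] ∷ + 0 ∷ + 1 ∷ [])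
  ∷ (-[1+ 1 ] ∷ -[1+ 0 ] ∷ + 3 ∷ + 0 ∷ + 1 ∷ + 1 ∷ -[1+ 0 ] ∷ -[1+ 0 ] ∷ + 0 ∷ + 0 ∷ [])
  ∷ (-[1+ 2 ] ∷ -[1+ 2 ] ∷ + 4 ∷ + 1 ∷ + 3 ∷ + 0 ∷ -[1+ 3 ] ∷ + 1 ∷ + 2 ∷ + 1 ∷ [])
  ∷ (+ 0 ∷ + 1 ∷ + 0 ∷ + 0 ∷ + 0 ∷ + 1 ∷ + 1 ∷ + 0 ∷ + 0 ∷ + 0 ∷ [])
  ∷ (+ 0 ∷ + 0 ∷ + 0 ∷ + 0 ∷ + 0 ∷ + 0 ∷ + 0 ∷ -[1+ 0 ] ∷ + 0 ∷ -[1+ 0 ] ∷ [])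
  ∷ (+ 0 ∷ -[1+ 0 ] ∷ + 0 ∷ + 0 ∷ + 0 ∷ -[1+ 0 ] ∷ -[1+ 0 ] ∷ + 0 ∷ + 0 ∷ + 0 ∷ [])
  ∷ []

coeffsP : List ℕ
coeffsP = 164 ∷ 32 ∷ 94 ∷ 292 ∷ 86 ∷ 22 ∷ 78 ∷ 6 ∷ []

valuesP : List (List ℤ)
valuesP =
    (+ 0 ∷ + 0 ∷ + 0 ∷ + 0 ∷ + 0 ∷ + 0 ∷ + 0 ∷ + 0 ∷ [])
  ∷ (-[1+ 1 ] ∷ -[1+ 2 ] ∷ -[1+ 1 ] ∷ -[1+ 0 ] ∷ + 1 ∷ -[1+ 0 ] ∷ -[1+ 0 ] ∷ + 2 ∷ [])
  ∷ (-[1+ 3 ] ∷ -[1+ 3 ] ∷ -[1+ 3 ] ∷ -[1+ 1 ] ∷ + 4 ∷ -[1+ 7 ] ∷ -[1+ 1 ] ∷ + 13 ∷ [])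
  ∷ (+ 0 ∷ + 0 ∷ + 0 ∷ + 1 ∷ + 1 ∷ + 1 ∷ + 1 ∷ + 0 ∷ [])
  ∷ (+ 0 ∷ + 0 ∷ + 0 ∷ -[1+ 0 ] ∷ -[1+ 0 ] ∷ -[1+ 1 ] ∷ -[1+ 0 ] ∷ + 1 ∷ [])
  ∷ (+ 3 ∷ + 6 ∷ + 4 ∷ -[1+ 2 ] ∷ -[1+ 5 ] ∷ + 3 ∷ -[1+ 2 ] ∷ -[1+ 3 ] ∷ [])
  ∷ (+ 0 ∷ -[1+ 1 ] ∷ + 0 ∷ + 6 ∷ + 4 ∷ + 6 ∷ + 6 ∷ -[1+ 2 ] ∷ [])
  ∷ (+ 1 ∷ + 1 ∷ + 1 ∷ + 2 ∷ + 0 ∷ + 2 ∷ + 1 ∷ -[1+ 2 ] ∷ [])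
  ∷ (+ 4 ∷ + 6 ∷ + 4 ∷ + 0 ∷ -[1+ 3 ] ∷ + 2 ∷ + 0 ∷ -[1+ 5 ] ∷ [])
  ∷ []

hd : List ℤ → ℤ
hd []      = 0ℤ
hd (x ∷ _) = x

tl : List ℤ → List ℤ
tl []      = []
tl (_ ∷ u) = u

gram : List ℕ → List ℤ → List ℤ → ℤ
gram []       u v = 0ℤ
gram (c ∷ cs) u v = + c ℤ.* (hd u ℤ.* hd v) ℤ.+ gram cs (tl u) (tl v)

gram-comm : ∀ cs u v → gram cs u v ≡ gram cs v u
gram-comm []       u v = refl
gram-comm (c ∷ cs) u v = cong₂ (λ x y → + c ℤ.* x ℤ.+ y) (ℤ.*-comm (hd u) (hd v)) (gram-comm cs (tl u) (tl v))

gram-zeroˡ : ∀ cs v → gram cs [] v ≡ 0ℤ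
gram-zeroˡ []       v = refl
gram-zeroˡ (c ∷ cs) v = cong₂ ℤ._+_ (ℤ.*-zeroʳ (+ c)) (gram-zeroˡ cs (tl v))

gramTable : List ℕ → List (List ℤ) → List (List ℤ)
gramTable cs us = map (λ u → map (gram cs u) us) us

-- Valid outside the table as well: there the row is `[]`, which `gram` reads as the zero vector.
entry-gram : ∀ cs us i j → entry (gramTable cs us) i j ≡ gram cs (nth [] us i) (nth [] us j)
entry-gram cs us = rows us
  where
  columns : ∀ u vs j → nth 0ℤ (map (gram cs u) vs) j ≡ gram cs u (nth [] vs j)
  columns u []       j       = sym (trans (gram-comm cs u []) (gram-zeroˡ cs u))
  columns u (v ∷ vs) zero    = refl
  columns u (v ∷ vs) (suc j) = columns u vs j
  rows : ∀ vs i j → entry (map (λ u → map (gram cs u) us) vs) i j ≡ gram cs (nth [] vs i) (nth [] us j)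
  rows []       i       j = sym (gram-zeroˡ cs _)
  rows (v ∷ vs) zero    j = columns v us j
  rows (v ∷ vs) (suc i) j = rows vs i j

-- These three equations, checked by evaluation, carry positive semidefiniteness: a Gram form with
-- natural coefficients is a sum of squares.
tableA≡ : tableA ≡ gramTable coeffsA valuesA
tableA≡ = refl

tableB≡ : tableB ≡ gramTable coeffsB valuesB
tableB≡ = refl

tableP≡ : tableP ≡ gramTable coeffsP valuesP
tableP≡ = refl

entry-comm : ∀ {T} cs us → T ≡ gramTable cs us → ∀ i j → entry T i j ≡ entry T j i
entry-comm cs us refl i j =
  trans (entry-gram cs us i j) (trans (gram-comm cs (nth [] us i) (nth [] us j)) (sym (entry-gram cs us j i)))

-- Exhaustive checks and the symmetries of the link classes

∧-trueˡ : ∀ {b c} → b ∧ c ≡ true → b ≡ true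
∧-trueˡ {true} _ = refl

∧-trueʳ : ∀ {b c} → b ∧ c ≡ true → c ≡ true
∧-trueʳ {true} e = e

all1-sound : ∀ n P → all1 n P ≡ true → ∀ s → P s ≡ true
all1-sound zero    P e s           = e
all1-sound (suc n) P e (false , s) = all1-sound n _ (∧-trueˡ e) s
all1-sound (suc n) P e (true , s)  = all1-sound n _ (∧-trueʳ {all1 n (λ s → P (false , s))} e) s

all2-sound : ∀ n P → all2 n P ≡ true → ∀ s → P s ≡ true
all2-sound zero    P e s       = e
all2-sound (suc n) P e (s , r) = all2-sound n _ (all1-sound n _ e s) r

all3-sound : ∀ n P → all3 n P ≡ true → ∀ s → P s ≡ true
all3-sound zero    P e s       = e
all3-sound (suc n) P e (s , r) = all3-sound n _ (all2-sound n _ e s) r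

equal⁶ : (f g : Bool⁶→ ℕ) → Set
equal⁶ f g = ∀ ab ac bc ad bd cd → f ab ac bc ad bd cd ≡ g ab ac bc ad bd cd

agree⁶ : Bool⁶→ ℕ → Bool⁶→ ℕ → S1 6 → Bool
agree⁶ f g (ab , ac , bc , ad , bd , cd , _) = f ab ac bc ad bd cd ≡ᵇ g ab ac bc ad bd cd

check⁶-sound : ∀ {f g} → all1 6 (agree⁶ f g) ≡ true → equal⁶ f g
check⁶-sound {f} {g} e ab ac bc ad bd cd =
  ℕ.≡ᵇ⇒≡ _ _ (subst T (sym (all1-sound 6 (agree⁶ f g) e (ab , ac , bc , ad , bd , cd , _))) _)

classA-ab : equal⁶ (λ ab ac bc ad bd cd → classA ab bc ac bd ad cd) classA
classA-ab = check⁶-sound refl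

-- Together with the exchange of a and b this generates all permutations of the edge abc.
classA-bc : equal⁶ (λ ab ac bc ad bd cd → classA ac ab bc ad cd bd) classA
classA-bc = check⁶-sound refl

classB-ab : equal⁶ (λ ab ac bc ad bd cd → classB ab bc ac bd ad cd) classB
classB-ab = check⁶-sound refl

classB-cd : equal⁶ (λ ab ac bc ad bd cd → classB ab ad bd ac bc cd) classB
classB-cd = check⁶-sound refl

oneEdge-ab : ∀ abc abd acd bcd {v} → oneEdge abc abd bcd acd v ≡ oneEdge abc abd acd bcd v
oneEdge-ab false _     _     _     = refl
oneEdge-ab true  true  _     _     = refl
oneEdge-ab true  false true  true  = refl
oneEdge-ab true  false true  false = refl
oneEdge-ab true  false false true  = refl
oneEdge-ab true  false false false = refl

oneEdge-bc : ∀ abc abd acd bcd {v} → oneEdge abc acd abd bcd v ≡ oneEdge abc abd acd bcd v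
oneEdge-bc false _     _     _ = refl
oneEdge-bc true  true  true  _ = refl
oneEdge-bc true  true  false _ = refl
oneEdge-bc true  false true  _ = refl
oneEdge-bc true  false false _ = refl

twoEdges-ab : ∀ abc abd acd bcd {v} → twoEdges abc abd bcd acd v ≡ twoEdges abc abd acd bcd v
twoEdges-ab false _     _     _     = refl
twoEdges-ab true  false _     _     = refl
twoEdges-ab true  true  true  true  = refl
twoEdges-ab true  true  true  false = refl
twoEdges-ab true  true  false true  = refl
twoEdges-ab true  true  false false = refl

twoEdges-cd : ∀ abc abd acd bcd {v} → twoEdges abd abc acd bcd v ≡ twoEdges abc abd acd bcd v
twoEdges-cd true  true  _ _ = refl
twoEdges-cd true  false _ _ = refl
twoEdges-cd false true  _ _ = refl
twoEdges-cd false false _ _ = refl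

ℤ-monoid : IsCommutativeMonoid _≡_ ℤ._+_ 0ℤ
ℤ-monoid = ℤ.+-0-isCommutativeMonoid

module GraphInvariance {V : Set} (E : V → V → V → Bool)
  (s₁₂ : ∀ a b c → E a b c ≡ E b a c) (s₂₃ : ∀ a b c → E a b c ≡ E a c b) where

  open Graph E

  edges-invariant : Invariant edges
  edges-invariant = choose-invariant ℕ.+-0-isCommutativeMonoid
    (λ q → at3-invariant (λ a b c → cong ind (s₁₂ a b c)) (λ a b c → cong ind (s₂₃ a b c))) (λ p h → refl) 3

  costSum-invariant : Invariant costSum
  costSum-invariant = choose-invariant ℤ-monoid
    (λ q → at3-invariant (λ a b c → cong cost (s₁₂ a b c)) (λ a b c → cong cost (s₂₃ a b c))) (λ p h → refl) 3

  module _ (κ : Bool⁶→ ℕ) where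

    link-ab : equal⁶ (λ ab ac bc ad bd cd → κ ab bc ac bd ad cd) κ → ∀ a b c d x → link κ b a c d x ≡ link κ a b c d x
    link-ab h a b c d x rewrite s₁₂ b a x = h _ _ _ _ _ _

    link-bc : equal⁶ (λ ab ac bc ad bd cd → κ ac ab bc ad cd bd) κ → ∀ a b c d x → link κ a c b d x ≡ link κ a b c d x
    link-bc h a b c d x rewrite s₁₂ c b x = h _ _ _ _ _ _

    link-cd : equal⁶ (λ ab ac bc ad bd cd → κ ab ad bd ac bc cd) κ → ∀ a b c d x → link κ a b d c x ≡ link κ a b c d x
    link-cd h a b c d x rewrite s₁₂ d c x = h _ _ _ _ _ _

  leafA-ab : ∀ a b c d q → leafA a b c d q ≡ leafA b a c d q
  leafA-ab a b c d q rewrite s₁₂ b a c | s₁₂ b a d = sym (trans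
    (oneEdge-ab (E a b c) (E a b d) (E a c d) (E b c d))
    (cong (oneEdge (E a b c) (E a b d) (E a c d) (E b c d)) (at2-cong (λ x y →
      cong₂ (entry tableA) (link-ab classA classA-ab a b c d x) (link-ab classA classA-ab a b c d y)) q)))

  leafA-bc : ∀ a b c d q → leafA a b c d q ≡ leafA a c b d q
  leafA-bc a b c d q rewrite s₂₃ a c b | s₁₂ c b d = sym (trans
    (oneEdge-bc (E a b c) (E a b d) (E a c d) (E b c d))
    (cong (oneEdge (E a b c) (E a b d) (E a c d) (E b c d)) (at2-cong (λ x y →
      cong₂ (entry tableA) (link-bc classA classA-bc a b c d x) (link-bc classA classA-bc a b c d y)) q)))

  leafB-ab : ∀ a b c d q → leafB a b c d q ≡ leafB b a c d q
  leafB-ab a b c d q rewrite s₁₂ b a c | s₁₂ b a d = sym (trans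
    (twoEdges-ab (E a b c) (E a b d) (E a c d) (E b c d))
    (cong (twoEdges (E a b c) (E a b d) (E a c d) (E b c d)) (at2-cong (λ x y →
      cong₂ (entry tableB) (link-ab classB classB-ab a b c d x) (link-ab classB classB-ab a b c d y)) q)))

  leafB-cd : ∀ a b c d q → leafB a b c d q ≡ leafB a b d c q
  leafB-cd a b c d q rewrite s₂₃ a d c | s₂₃ b d c = sym (trans
    (twoEdges-cd (E a b c) (E a b d) (E a c d) (E b c d))
    (cong (twoEdges (E a b c) (E a b d) (E a c d) (E b c d)) (at2-cong (λ x y →
      cong₂ (entry tableB) (link-cd classB classB-cd a b c d x) (link-cd classB classB-cd a b c d y)) q)))

  leafA-q : ∀ a b c d → Invariant (leafA a b c d)
  leafA-q a b c d h = cong (oneEdge (E a b c) (E a b d) (E a c d) (E b c d))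
    (at2-invariant (λ x y → entry-comm coeffsA valuesA tableA≡ (link classA a b c d x) (link classA a b c d y)) h)

  leafB-q : ∀ a b c d → Invariant (leafB a b c d)
  leafB-q a b c d h = cong (twoEdges (E a b c) (E a b d) (E a c d) (E b c d))
    (at2-invariant (λ x y → entry-comm coeffsB valuesB tableB≡ (link classB a b c d x) (link classB a b c d y)) h)

  types-invariant : Invariant types
  types-invariant = choose-invariant ℤ-monoid
    (λ q h → cong₂ ℤ._+_
      (choose-invariant ℤ-monoid {ψ = λ abc d → termA abc d q}
        (λ d → at3-invariant (λ a b c → at1-cong (λ d → leafA-ab a b c d q) d)
                             (λ a b c → at1-cong (λ d → leafA-bc a b c d q) d))
        (λ abc h → at3-cong (λ a b c → at1-invariant h) abc) 3 h)
      (choose-invariant ℤ-monoid {ψ = λ ab cd → termB ab cd q}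
        (λ cd → at2-invariant (λ a b → at2-cong (λ c d → leafB-ab a b c d q) cd))
        (λ ab h → at2-cong (λ a b → at2-invariant (λ c d → leafB-cd a b c d q) h) ab) 2 h))
    (λ p h → cong₂ ℤ._+_
      (choose-cong (λ abc d → at3-cong (λ a b c → at1-cong (λ d → leafA-q a b c d h) d) abc) 3 p)
      (choose-cong (λ ab cd → at2-cong (λ a b → at2-cong (λ c d → leafB-q a b c d h) cd) ab) 2 p)) 4

  linkP-uv : ∀ u v x y → linkP u v x y ≡ linkP v u x y
  linkP-uv u v x y rewrite s₁₂ v u x | s₁₂ v u y | ℕ.+-comm (ind (E v x y)) (ind (E u x y)) = refl

  linkP-xy : ∀ u v x y → linkP u v x y ≡ linkP u v y x
  linkP-xy u v x y rewrite s₂₃ u y x | s₂₃ v y x | ℕ.+-comm (ind (E u v y)) (ind (E u v x)) = refl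

  pairs-invariant : Invariant pairs
  pairs-invariant = choose-invariant ℤ-monoid
    (λ q h → choose-cong (λ r s → at2-invariant (λ u v → at2-cong (λ x y → at2-cong (λ z t →
      cong₂ (entry tableP) (linkP-uv u v x y) (linkP-uv u v z t)) s) r) h) 2 q)
    (λ p → choose-invariant ℤ-monoid
      (λ s h → at2-cong (λ u v → at2-invariant (λ x y → at2-cong (λ z t →
        cong (λ i → entry tableP i (linkP u v z t)) (linkP-xy u v x y)) s) h) p)
      (λ r h → at2-cong (λ u v → at2-cong (λ x y → at2-invariant (λ z t →
        cong (entry tableP (linkP u v x y)) (linkP-xy u v z t)) h) r) p) 2) 2

-- Sums over tuples of vertices

open SemiringSum ℤ.+-*-semiring using (sum; sum-cong-≗; ∑-distrib-+; ∑-comm; *-distribˡ-sum)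

sum-nonneg : ∀ {n} (f : Fin n → ℤ) → (∀ i → 0ℤ ℤ.≤ f i) → 0ℤ ℤ.≤ sum f
sum-nonneg {zero}  f h = ℤ.≤-refl
sum-nonneg {suc n} f h = ℤ.+-mono-≤ (h zero) (sum-nonneg (f ∘ suc) (h ∘ suc))

-- The recursion of `choose` on a list of length `m` with the entries forgotten: `f i j` is the
-- value for `i` chosen and `j` remaining entries, added once per subset.
repeated : ℕ → ℕ → (ℕ → ℕ → ℤ) → ℤ
repeated m       zero    f = f 0 m
repeated zero    (suc k) f = 0ℤ
repeated (suc m) (suc k) f = repeated m k (λ i j → f (suc i) j) ℤ.+ repeated m (suc k) (λ i j → f i (suc j))

repeated-cong : ∀ m k {f g} → (∀ i j → f i j ≡ g i j) → repeated m k f ≡ repeated m k g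
repeated-cong m       zero    h = h 0 m
repeated-cong zero    (suc k) h = refl
repeated-cong (suc m) (suc k) h =
  cong₂ ℤ._+_ (repeated-cong m k (λ i → h (suc i))) (repeated-cong m (suc k) (λ i j → h i (suc j)))

repeated-sum : ∀ m k {o} (f : Fin o → ℕ → ℕ → ℤ) →
  sum (λ a → repeated m k (f a)) ≡ repeated m k (λ i j → sum λ a → f a i j)
repeated-sum m       zero    f = refl
repeated-sum zero    (suc k) {o} f = sym (*-distribˡ-sum {o} 0ℤ (λ _ → 0ℤ))
repeated-sum (suc m) (suc k) f = trans (∑-distrib-+ (λ a → repeated m k (λ i → f a (suc i))) _)
  (cong₂ ℤ._+_ (repeated-sum m k (λ a i → f a (suc i))) (repeated-sum m (suc k) (λ a i j → f a i (suc j))))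

-- The binomial coefficient, by the recursion of `repeated`, so that `count 6 3` evaluates to 20.
count : ℕ → ℕ → ℕ
count m       zero    = 1
count zero    (suc k) = 0
count (suc m) (suc k) = count m k ℕ.+ count m (suc k)

repeated-const : ∀ m k f x → (∀ j → k ℕ.+ j ≡ m → f k j ≡ x) → repeated m k f ≡ + count m k ℤ.* x
repeated-const m       zero    f x h = trans (h m refl) (sym (ℤ.*-identityˡ x))
repeated-const zero    (suc k) f x h = refl
repeated-const (suc m) (suc k) f x h = begin
  repeated m k (λ i j → f (suc i) j) ℤ.+ repeated m (suc k) (λ i j → f i (suc j))
    ≡⟨ cong₂ ℤ._+_ (repeated-const m k _ x (λ j e → h j (cong suc e)))
         (repeated-const m (suc k) _ x (λ j e → h (suc j) (trans (cong suc (ℕ.+-suc k j)) (cong suc e)))) ⟩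
  + count m k ℤ.* x ℤ.+ + count m (suc k) ℤ.* x
    ≡⟨ ℤ.*-distribʳ-+ x (+ count m k) (+ count m (suc k)) ⟨
  + (count m k ℕ.+ count m (suc k)) ℤ.* x ∎
  where open ≡-Reasoning

module _ {n : ℕ} where

  sumLists : ℕ → (List (Fin n) → ℤ) → ℤ
  sumLists zero    F = F []
  sumLists (suc k) F = sum λ a → sumLists k (λ l → F (a ∷ l))

  sumLists-cong : ∀ k {F G} → (∀ l → F l ≡ G l) → sumLists k F ≡ sumLists k G
  sumLists-cong zero    h = h []
  sumLists-cong (suc k) h = sum-cong-≗ (λ a → sumLists-cong k (λ l → h (a ∷ l)))

  sumLists-nonneg : ∀ k F → (∀ l → length l ≡ k → 0ℤ ℤ.≤ F l) → 0ℤ ℤ.≤ sumLists k F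
  sumLists-nonneg zero    F h = h [] refl
  sumLists-nonneg (suc k) F h = sum-nonneg _ (λ a → sumLists-nonneg k _ (λ l e → h (a ∷ l) (cong suc e)))

  sumLists-+ : ∀ k F G → sumLists k (λ l → F l ℤ.+ G l) ≡ sumLists k F ℤ.+ sumLists k G
  sumLists-+ zero    F G = refl
  sumLists-+ (suc k) F G = trans (sum-cong-≗ (λ a → sumLists-+ k (λ l → F (a ∷ l)) (λ l → G (a ∷ l))))
    (∑-distrib-+ (λ a → sumLists k (λ l → F (a ∷ l))) (λ a → sumLists k (λ l → G (a ∷ l))))

  sumLists-sum : ∀ k {m} (F : Fin m → List (Fin n) → ℤ) →
    sumLists k (λ l → sum λ a → F a l) ≡ sum λ a → sumLists k (F a)
  sumLists-sum zero    F = refl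
  sumLists-sum (suc k) F = trans (sum-cong-≗ (λ b → sumLists-sum k (λ a l → F a (b ∷ l))))
    (∑-comm (λ b a → sumLists k (λ l → F a (b ∷ l))))

  chooseℤ : (List (Fin n) → List (Fin n) → ℤ) → ℕ → List (Fin n) → ℤ
  chooseℤ = choose ℤ._+_ 0ℤ

  chooseℤ-nonneg : ∀ ψ → (∀ p q → 0ℤ ℤ.≤ ψ p q) → ∀ k l → 0ℤ ℤ.≤ chooseℤ ψ k l
  chooseℤ-nonneg ψ h zero    l       = h [] l
  chooseℤ-nonneg ψ h (suc k) []      = ℤ.≤-refl
  chooseℤ-nonneg ψ h (suc k) (x ∷ l) =
    ℤ.+-mono-≤ (chooseℤ-nonneg _ (λ p → h (x ∷ p)) k l) (chooseℤ-nonneg _ (λ p q → h p (x ∷ q)) (suc k) l)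

  sumLists-choose-comm : ∀ j (φ : List (Fin n) → List (Fin n) → List (Fin n) → ℤ) k l →
    sumLists j (λ r → chooseℤ (λ p q → φ p q r) k l) ≡ chooseℤ (λ p q → sumLists j (φ p q)) k l
  sumLists-choose-comm j φ zero    l       = refl
  sumLists-choose-comm j φ (suc k) []      = zeros j
    where
    zeros : ∀ j → sumLists j (λ _ → 0ℤ) ≡ 0ℤ
    zeros zero    = refl
    zeros (suc j) = trans (sum-cong-≗ {n} (λ _ → zeros j)) (sym (*-distribˡ-sum {n} 0ℤ (λ _ → 0ℤ)))
  sumLists-choose-comm j φ (suc k) (x ∷ l) = trans (sumLists-+ j _ _)
    (cong₂ ℤ._+_ (sumLists-choose-comm j (λ p → φ (x ∷ p)) k l)
                 (sumLists-choose-comm j (λ p q → φ p (x ∷ q)) (suc k) l))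

  -- In a sum over all tuples the chosen and the remaining positions range independently, so every
  -- subset of positions gives the same double sum.
  sumLists-choose : ∀ m k ψ → sumLists m (chooseℤ ψ k) ≡
    repeated m k (λ i j → sumLists i (λ p → sumLists j (ψ p)))
  sumLists-choose m       zero    ψ = refl
  sumLists-choose zero    (suc k) ψ = refl
  sumLists-choose (suc m) (suc k) ψ = begin
    (sum λ x → sumLists m (λ l → chooseℤ (λ p → ψ (x ∷ p)) k l ℤ.+ chooseℤ (λ p q → ψ p (x ∷ q)) (suc k) l))
      ≡⟨ sum-cong-≗ (λ x → sumLists-+ m (chooseℤ (λ p → ψ (x ∷ p)) k) (chooseℤ (λ p q → ψ p (x ∷ q)) (suc k))) ⟩
    (sum λ x → sumLists m (chooseℤ (λ p → ψ (x ∷ p)) k) ℤ.+ sumLists m (chooseℤ (λ p q → ψ p (x ∷ q)) (suc k)))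
      ≡⟨ sum-cong-≗ (λ x → cong₂ ℤ._+_ (sumLists-choose m k (λ p → ψ (x ∷ p))) (sumLists-choose m (suc k) (λ p q → ψ p (x ∷ q)))) ⟩
    (sum λ x → repeated m k (λ i j → sumLists i (λ p → sumLists j (ψ (x ∷ p))))
            ℤ.+ repeated m (suc k) (λ i j → sumLists i (λ p → sumLists j (λ q → ψ p (x ∷ q)))))
      ≡⟨ ∑-distrib-+ (λ x → repeated m k (λ i j → sumLists i (λ p → sumLists j (ψ (x ∷ p)))))
             (λ x → repeated m (suc k) (λ i j → sumLists i (λ p → sumLists j (λ q → ψ p (x ∷ q))))) ⟩
    _ ≡⟨ cong₂ ℤ._+_ (repeated-sum m k (λ x i j → sumLists i (λ p → sumLists j (ψ (x ∷ p)))))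
           (trans (repeated-sum m (suc k) (λ x i j → sumLists i (λ p → sumLists j (λ q → ψ p (x ∷ q)))))
           (repeated-cong m (suc k) (λ i j → sym (sumLists-sum i (λ x p → sumLists j (λ q → ψ p (x ∷ q))))))) ⟩
    _ ∎
    where open ≡-Reasoning

  sumLists-*ˡ : ∀ k c F → sumLists k (λ l → c ℤ.* F l) ≡ c ℤ.* sumLists k F
  sumLists-*ˡ zero    c F = refl
  sumLists-*ˡ (suc k) c F = trans (sum-cong-≗ (λ a → sumLists-*ˡ k c (λ l → F (a ∷ l))))
    (sym (*-distribˡ-sum c (λ a → sumLists k (λ l → F (a ∷ l)))))

  sumLists-*ʳ : ∀ k c F → sumLists k (λ l → F l ℤ.* c) ≡ sumLists k F ℤ.* c
  sumLists-*ʳ k c F = trans (sumLists-cong k (λ l → ℤ.*-comm (F l) c))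
    (trans (sumLists-*ˡ k c F) (ℤ.*-comm c (sumLists k F)))

*-nonneg : ∀ {x y} → 0ℤ ℤ.≤ x → 0ℤ ℤ.≤ y → 0ℤ ℤ.≤ x ℤ.* y
*-nonneg {+ a} {+ b} _ _ = subst (0ℤ ℤ.≤_) (ℤ.pos-* a b) (ℤ.+≤+ ℕ.z≤n)

square-nonneg : ∀ x → 0ℤ ℤ.≤ x ℤ.* x
square-nonneg (+ a)    = *-nonneg {+ a} {+ a} (ℤ.+≤+ ℕ.z≤n) (ℤ.+≤+ ℕ.z≤n)
square-nonneg -[1+ a ] = ℤ.+≤+ ℕ.z≤n

module _ {n : ℕ} where

  -- As `p` and `q` run independently over the same tuples, each summand of `gram` totals its
  -- coefficient times a square.
  gram-sum-nonneg : ∀ k cs (u : List (Fin n) → List ℤ) →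
    0ℤ ℤ.≤ sumLists k (λ p → sumLists k (λ q → gram cs (u p) (u q)))
  gram-sum-nonneg k []       u = sumLists-nonneg {n} k _ λ p _ → sumLists-nonneg {n} k _ λ q _ → ℤ.≤-refl
  gram-sum-nonneg k (c ∷ cs) u = subst (0ℤ ℤ.≤_) (sym expand)
    (ℤ.+-mono-≤ (*-nonneg {+ c} (ℤ.+≤+ ℕ.z≤n) (square-nonneg S)) (gram-sum-nonneg k cs (λ p → tl (u p))))
    where
    open ≡-Reasoning
    h : List (Fin n) → ℤ
    h p = hd (u p)
    g : List (Fin n) → List (Fin n) → ℤ
    g p q = gram cs (tl (u p)) (tl (u q))
    S : ℤ
    S = sumLists k h
    inner : ∀ p → sumLists k (λ q → + c ℤ.* (h p ℤ.* h q) ℤ.+ g p q) ≡ + c ℤ.* (h p ℤ.* S) ℤ.+ sumLists k (g p)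
    inner p = trans (sumLists-+ k (λ q → + c ℤ.* (h p ℤ.* h q)) (g p)) (cong (ℤ._+ sumLists k (g p))
      (trans (sumLists-*ˡ k (+ c) (λ q → h p ℤ.* h q)) (cong (+ c ℤ.*_) (sumLists-*ˡ k (h p) h))))
    expand : sumLists k (λ p → sumLists k (λ q → gram (c ∷ cs) (u p) (u q)))
           ≡ + c ℤ.* (S ℤ.* S) ℤ.+ sumLists k (λ p → sumLists k (g p))
    expand = begin
      sumLists k (λ p → sumLists k (λ q → gram (c ∷ cs) (u p) (u q)))
        ≡⟨ sumLists-cong k inner ⟩
      sumLists k (λ p → + c ℤ.* (h p ℤ.* S) ℤ.+ sumLists k (g p))
        ≡⟨ sumLists-+ k (λ p → + c ℤ.* (h p ℤ.* S)) (λ p → sumLists k (g p)) ⟩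
      sumLists k (λ p → + c ℤ.* (h p ℤ.* S)) ℤ.+ sumLists k (λ p → sumLists k (g p))
        ≡⟨ cong (ℤ._+ sumLists k (λ p → sumLists k (g p)))
             (trans (sumLists-*ˡ k (+ c) (λ p → h p ℤ.* S)) (cong (+ c ℤ.*_) (sumLists-*ʳ k S h))) ⟩
      + c ℤ.* (S ℤ.* S) ℤ.+ sumLists k (λ p → sumLists k (g p)) ∎

  entry-sum-nonneg : ∀ {T} k cs us → T ≡ gramTable cs us → (i : List (Fin n) → ℕ) →
    0ℤ ℤ.≤ sumLists k (λ p → sumLists k (λ q → entry T (i p) (i q)))
  entry-sum-nonneg k cs us refl i = subst (0ℤ ℤ.≤_)
    (sumLists-cong k (λ p → sumLists-cong k (λ q → sym (entry-gram cs us (i p) (i q)))))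
    (gram-sum-nonneg k cs (λ p → nth [] us (i p)))

  sumLists-subsets-nonneg : ∀ m k ψ → (∀ j → k ℕ.+ j ≡ m → 0ℤ ℤ.≤ sumLists k (λ p → sumLists j (ψ p))) →
    0ℤ ℤ.≤ sumLists {n} m (chooseℤ ψ k)
  sumLists-subsets-nonneg m k ψ h = subst (0ℤ ℤ.≤_) (sym (sumLists-choose m k ψ)) (nonneg m k _ h)
    where
    nonneg : ∀ m k (f : ℕ → ℕ → ℤ) → (∀ j → k ℕ.+ j ≡ m → 0ℤ ℤ.≤ f k j) → 0ℤ ℤ.≤ repeated m k f
    nonneg m       zero    f h = h m refl
    nonneg zero    (suc k) f h = ℤ.≤-refl
    nonneg (suc m) (suc k) f h = ℤ.+-mono-≤ (nonneg m k _ (λ j e → h j (cong suc e)))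
      (nonneg m (suc k) _ (λ j e → h (suc j) (trans (cong suc (ℕ.+-suc k j)) (cong suc e))))

module GraphSums {n : ℕ} (E : Fin n → Fin n → Fin n → Bool) where

  open Graph E

  zeroSum : 0ℤ ℤ.≤ sumLists {n} 2 (λ _ → 0ℤ)
  zeroSum = sumLists-nonneg {n} 2 _ (λ _ _ → ℤ.≤-refl)

  leafA-nonneg : ∀ a b c d → 0ℤ ℤ.≤ sumLists 2 (leafA a b c d)
  leafA-nonneg a b c d with E a b c ∧ not (E a b d ∨ E a c d ∨ E b c d)
  -- The sum over the pair x, y is by definition a double sum over tuples of length 1.
  ... | true  = entry-sum-nonneg 1 coeffsA valuesA tableA≡ (at1 0 (link classA a b c d))
  ... | false = zeroSum

  leafB-nonneg : ∀ a b c d → 0ℤ ℤ.≤ sumLists 2 (leafB a b c d)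
  leafB-nonneg a b c d with E a b c ∧ E a b d ∧ not (E a c d ∨ E b c d)
  ... | true  = entry-sum-nonneg 1 coeffsB valuesB tableB≡ (at1 0 (link classB a b c d))
  ... | false = zeroSum

  termA-nonneg : ∀ abc d → 0ℤ ℤ.≤ sumLists 2 (termA abc d)
  termA-nonneg (a ∷ b ∷ c ∷ [])    (d ∷ [])    = leafA-nonneg a b c d
  termA-nonneg (_ ∷ _ ∷ _ ∷ [])    []          = zeroSum
  termA-nonneg (_ ∷ _ ∷ _ ∷ [])    (_ ∷ _ ∷ _) = zeroSum
  termA-nonneg []                  _           = zeroSum
  termA-nonneg (_ ∷ [])            _           = zeroSum
  termA-nonneg (_ ∷ _ ∷ [])        _           = zeroSum
  termA-nonneg (_ ∷ _ ∷ _ ∷ _ ∷ _) _           = zeroSum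

  termB-nonneg : ∀ ab cd → 0ℤ ℤ.≤ sumLists 2 (termB ab cd)
  termB-nonneg (a ∷ b ∷ [])    (c ∷ d ∷ [])    = leafB-nonneg a b c d
  termB-nonneg (_ ∷ _ ∷ [])    []              = zeroSum
  termB-nonneg (_ ∷ _ ∷ [])    (_ ∷ [])        = zeroSum
  termB-nonneg (_ ∷ _ ∷ [])    (_ ∷ _ ∷ _ ∷ _) = zeroSum
  termB-nonneg []              _               = zeroSum
  termB-nonneg (_ ∷ [])        _               = zeroSum
  termB-nonneg (_ ∷ _ ∷ _ ∷ _) _               = zeroSum

  types-nonneg : 0ℤ ℤ.≤ sumLists 6 types
  types-nonneg = sumLists-subsets-nonneg 6 4 splitType λ { 2 refl → sumLists-nonneg {n} 4 _ λ p _ →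
    subst (0ℤ ℤ.≤_) (sym (trans
        (sumLists-+ 2 (λ q → chooseℤ (λ abc d → termA abc d q) 3 p) (λ q → chooseℤ (λ ab cd → termB ab cd q) 2 p))
        (cong₂ ℤ._+_ (sumLists-choose-comm 2 termA 3 p) (sumLists-choose-comm 2 termB 2 p))))
      (ℤ.+-mono-≤ (chooseℤ-nonneg _ termA-nonneg 3 p) (chooseℤ-nonneg _ termB-nonneg 2 p)) }

  pairs-nonneg : 0ℤ ℤ.≤ sumLists 6 pairs
  pairs-nonneg = sumLists-subsets-nonneg 6 2 splitPair λ { 4 refl →
    sum-nonneg {n} _ λ u → sum-nonneg {n} _ λ v → sumLists-subsets-nonneg 4 2 (termP (u ∷ v ∷ [])) λ { 2 refl →
      entry-sum-nonneg 2 coeffsP valuesP tableP≡ (at2 0 (linkP u v)) } }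

  costSum-sum : sumLists 6 costSum ≡ + 20 ℤ.* (sumLists 3 costAt ℤ.* sumLists {n} 3 (λ _ → + 1))
  costSum-sum = trans (sumLists-choose {n} 6 3 (λ p _ → costAt p))
    (repeated-const 6 3 (λ i j → sumLists {n} i (λ p → sumLists {n} j (λ _ → costAt p))) (sumLists 3 costAt ℤ.* sumLists {n} 3 (λ _ → + 1)) λ { 3 refl →
    trans (sumLists-cong {n} 3 (λ p → trans (sumLists-cong {n} 3 (λ _ → sym (ℤ.*-identityʳ (costAt p))))
                                        (sumLists-*ˡ {n} 3 (costAt p) (λ _ → + 1))))
          (sumLists-*ʳ {n} 3 (sumLists {n} 3 (λ _ → + 1)) costAt) })

-- The inequality for six vertices

∧-false : ∀ b {c} → b ∧ c ≡ false → b ≡ false ⊎ c ≡ false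
∧-false false e = inj₁ refl
∧-false true  e = inj₂ e

∨-true : ∀ b {c} → b ∨ c ≡ true → b ≡ true ⊎ c ≡ true
∨-true true  e = inj₁ refl
∨-true false e = inj₂ e

modus-ponens : ∀ {b c} → not b ∨ c ≡ true → b ≡ true → c ≡ true
modus-ponens e refl = e

every : (List A → List A → Bool) → ℕ → List A → Bool
every = choose _∧_ true

every-true : (ψ : List A → List A → Bool) → (∀ p q → ψ p q ≡ true) → ∀ k l → every ψ k l ≡ true
every-true ψ h zero    l       = h [] l
every-true ψ h (suc k) []      = refl
every-true ψ h (suc k) (x ∷ l) =
  cong₂ _∧_ (every-true _ (λ p → h (x ∷ p)) k l) (every-true _ (λ p q → h p (x ∷ q)) (suc k) l)

every-false : (ψ : List A → List A → Bool) → ∀ k l → every ψ k l ≡ false →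
  ∃₂ λ p q → length p ≡ k × p ++ q ↭ l × ψ p q ≡ false
every-false ψ zero    l       e = [] , l , refl , refl , e
every-false ψ (suc k) (x ∷ l) e with ∧-false (every (λ p → ψ (x ∷ p)) k l) e
... | inj₁ e₁ with p , q , n , h , e′ ← every-false _ k l e₁ = x ∷ p , q , cong suc n , prep x h , e′
... | inj₂ e₂ with p , q , n , h , e′ ← every-false _ (suc k) l e₂ =
  p , x ∷ q , n , ↭-trans (shift x p q) (prep x h) , e′

anyInsert-sound : (P : List A → Bool) → ∀ x l → anyInsert P x l ≡ true → ∃ λ l′ → l′ ↭ x ∷ l × P l′ ≡ true
anyInsert-sound P x []      e = x ∷ [] , refl , e
anyInsert-sound P x (y ∷ l) e with ∨-true (P (x ∷ y ∷ l)) e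
... | inj₁ e₁ = x ∷ y ∷ l , refl , e₁
... | inj₂ e₂ with l′ , h , e′ ← anyInsert-sound (λ zs → P (y ∷ zs)) x l e₂ =
  y ∷ l′ , ↭-trans (prep y h) (swap y x refl) , e′

anyPerm-sound : (P : List A → Bool) → ∀ l → anyPerm P l ≡ true → ∃ λ l′ → l′ ↭ l × P l′ ≡ true
anyPerm-sound P []      e = [] , refl , e
anyPerm-sound P (x ∷ l) e with l₁ , h₁ , e₁ ← anyPerm-sound (anyInsert P x) l e
                          with l₂ , h₂ , e₂ ← anyInsert-sound P x l₁ e₁ = l₂ , ↭-trans h₂ (prep x h₁) , e₂

tab1 : ∀ n → (Fin n → Bool) → S1 n
tab1 zero    e = _
tab1 (suc n) e = e zero , tab1 n (e ∘ suc)

tab2 : ∀ n → (Fin n → Fin n → Bool) → S2 n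
tab2 zero    e = _
tab2 (suc n) e = tab1 n (λ j → e zero (suc j)) , tab2 n (λ i j → e (suc i) (suc j))

tab3 : ∀ n → (Fin n → Fin n → Fin n → Bool) → S3 n
tab3 zero    e = _
tab3 (suc n) e = tab2 n (λ j k → e zero (suc j) (suc k)) , tab3 n (λ i j k → e (suc i) (suc j) (suc k))

E1-tab : ∀ n e i → e i ≡ E1 (tab1 n e) i
E1-tab (suc n) e zero    = refl
E1-tab (suc n) e (suc i) = E1-tab n (e ∘ suc) i

E2-tab : ∀ n e → (∀ i → e i i ≡ true) → (∀ i j → e i j ≡ e j i) → ∀ i j → e i j ≡ E2 (tab2 n e) i j
E2-tab (suc n) e d s zero    zero    = d zero
E2-tab (suc n) e d s zero    (suc j) = E1-tab n _ j
E2-tab (suc n) e d s (suc i) zero    = trans (s (suc i) zero) (E1-tab n _ i)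
E2-tab (suc n) e d s (suc i) (suc j) = E2-tab n _ (λ i → d (suc i)) (λ i j → s (suc i) (suc j)) i j

-- `tab3` records increasing triples only; symmetry and the value `true` on repeated vertices
-- restore the rest.
E3-tab : ∀ n e → (∀ i k → e i i k ≡ true) → (∀ i j k → e i j k ≡ e j i k) → (∀ i j k → e i j k ≡ e i k j) →
  ∀ i j k → e i j k ≡ E3 (tab3 n e) i j k
E3-tab (suc n) e d s t = go
  where
  link₀ : ∀ j k → e zero (suc j) (suc k) ≡ E2 (tab2 n (λ j k → e zero (suc j) (suc k))) j k
  link₀ = E2-tab n _ (λ j → trans (s zero (suc j) (suc j)) (trans (t (suc j) zero (suc j)) (d (suc j) zero)))
                     (λ j k → t zero (suc j) (suc k))
  go : ∀ i j k → e i j k ≡ E3 (tab3 (suc n) e) i j k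
  go zero    zero    k       = d zero k
  go zero    (suc j) zero    = trans (t zero (suc j) zero) (d zero (suc j))
  go zero    (suc j) (suc k) = link₀ j k
  go (suc i) zero    zero    = trans (s (suc i) zero zero) (trans (t zero (suc i) zero) (d zero (suc i)))
  go (suc i) zero    (suc k) = trans (s (suc i) zero (suc k)) (link₀ i k)
  go (suc i) (suc j) zero    = trans (t (suc i) (suc j) zero) (trans (s (suc i) zero (suc j)) (link₀ i j))
  go (suc i) (suc j) (suc k) = E3-tab n _ (λ i k → d (suc i) (suc k))
    (λ i j k → s (suc i) (suc j) (suc k)) (λ i j k → t (suc i) (suc j) (suc k)) i j k

BoundedBy : {V : Set} → (V → V → V → Bool) → List V → Set
BoundedBy E l = types l ℤ.+ pairs l ℤ.≤ costSum l
  where open Graph E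

-- `f` may identify vertices: a tuple with repetitions is the image of distinct vertices, and all
-- quantities depend only on the values of the relation.
module Pullback {V W : Set} (E : V → V → V → Bool) (E′ : W → W → W → Bool) (f : W → V)
  (h : ∀ a b c → E (f a) (f b) (f c) ≡ E′ a b c) where

  private
    module G = Graph E
    module G′ = Graph E′

  edges-map : ∀ l → G.edges (map f l) ≡ G′.edges l
  edges-map = choose-map f (λ p q → at3-map f (λ a b c → cong ind (h a b c)) p) 3

  costSum-map : ∀ l → G.costSum (map f l) ≡ G′.costSum l
  costSum-map = choose-map f (λ p q → at3-map f (λ a b c → cong G.cost (h a b c)) p) 3

  link-map : ∀ κ a b c d x → G.link κ (f a) (f b) (f c) (f d) (f x) ≡ G′.link κ a b c d x
  link-map κ a b c d x rewrite h a b x | h a c x | h b c x | h a d x | h b d x | h c d x = refl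

  leafA-map : ∀ a b c d q → G.leafA (f a) (f b) (f c) (f d) (map f q) ≡ G′.leafA a b c d q
  leafA-map a b c d q rewrite h a b c | h a b d | h a c d | h b c d =
    cong (oneEdge (E′ a b c) (E′ a b d) (E′ a c d) (E′ b c d)) (at2-map f (λ x y →
      cong₂ (entry tableA) (link-map classA a b c d x) (link-map classA a b c d y)) q)

  leafB-map : ∀ a b c d q → G.leafB (f a) (f b) (f c) (f d) (map f q) ≡ G′.leafB a b c d q
  leafB-map a b c d q rewrite h a b c | h a b d | h a c d | h b c d =
    cong (twoEdges (E′ a b c) (E′ a b d) (E′ a c d) (E′ b c d)) (at2-map f (λ x y →
      cong₂ (entry tableB) (link-map classB a b c d x) (link-map classB a b c d y)) q)

  types-map : ∀ l → G.types (map f l) ≡ G′.types l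
  types-map = choose-map f (λ p q → cong₂ ℤ._+_
    (choose-map f (λ abc d → at3-map f (λ a b c → at1-map f (λ d → leafA-map a b c d q) d) abc) 3 p)
    (choose-map f (λ ab cd → at2-map f (λ a b → at2-map f (λ c d → leafB-map a b c d q) cd) ab) 2 p)) 4

  linkP-map : ∀ u v x y → G.linkP (f u) (f v) (f x) (f y) ≡ G′.linkP u v x y
  linkP-map u v x y rewrite h u v x | h u v y | h u x y | h v x y = refl

  pairs-map : ∀ l → G.pairs (map f l) ≡ G′.pairs l
  pairs-map = choose-map f (λ p q → choose-map f (λ r s → at2-map f (λ u v → at2-map f (λ x y → at2-map f (λ z t →
    cong₂ (entry tableP) (linkP-map u v x y) (linkP-map u v z t)) s) r) p) 2 q) 2

  code-map : ∀ l → G.code (map f l) ≡ G′.code l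
  code-map l = cong (foldr (λ b m → ind b ℕ.+ 2 ℕ.* m) 0)
    (choose-map f (λ p q → at3-map f (λ a b c → cong (_∷ []) (h a b c)) p) 3 l)

  isRep-map : ∀ l → G.isRep (map f l) ≡ G′.isRep l
  isRep-map l rewrite code-map l = refl

  minimal-map : ∀ e l → G.minimal e (map f l) ≡ G′.minimal e l
  minimal-map e = choose-map f (λ p q → cong (e ≤ᵇ_) (edges-map q)) 1

  bounded-map : ∀ l → BoundedBy E′ l → BoundedBy E (map f l)
  bounded-map l = subst₂ ℤ._≤_ (sym (cong₂ ℤ._+_ (types-map l) (pairs-map l))) (sym (costSum-map l))

module PullbackFree {V W : Set} (E : V → V → V → Bool) (E′ : W → W → W → Bool) (f : W → V)
  (h : ∀ a b c → E (f a) (f b) (f c) ≡ E′ a b c)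
  (I4-free : ∀ a b c d → E a b c ∨ E a b d ∨ E a c d ∨ E b c d ≡ true)
  (H4-free : ∀ c a b d x → E c a b ≡ true → E c a d ≡ true → E c b d ≡ true → E a b d ≡ false →
    Graph.h4Free E c a b d x ≡ true)
  where

  open Graph E′

  noI4-holds : ∀ l → noI4 l ≡ true
  noI4-holds = every-true _ (λ p q → noI4-at p) 4
    where
    noI4-at : ∀ p → at4 true (λ a b c d → E′ a b c ∨ E′ a b d ∨ E′ a c d ∨ E′ b c d) p ≡ true
    noI4-at []                      = refl
    noI4-at (_ ∷ [])                = refl
    noI4-at (_ ∷ _ ∷ [])            = refl
    noI4-at (_ ∷ _ ∷ _ ∷ [])        = refl
    noI4-at (a ∷ b ∷ c ∷ d ∷ [])    = trans
      (sym (cong₂ _∨_ (h a b c) (cong₂ _∨_ (h a b d) (cong₂ _∨_ (h a c d) (h b c d)))))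
      (I4-free (f a) (f b) (f c) (f d))
    noI4-at (_ ∷ _ ∷ _ ∷ _ ∷ _ ∷ _) = refl

  h4Free-map : ∀ c a b d x → Graph.h4Free E (f c) (f a) (f b) (f d) (f x) ≡ h4Free c a b d x
  h4Free-map c a b d x rewrite h c a x | h c b x | h c d x | h a b x | h a d x | h b d x = refl

  noH4-holds : ∀ l → noH4 l ≡ true
  noH4-holds = every-true _ (λ p q → every-true _ (λ c abd → noH4-at c abd q) 1 p) 4
    where
    at : ∀ c a b d q → (if E′ c a b ∧ E′ c a d ∧ E′ c b d ∧ not (E′ a b d)
      then every (λ x _ → at1 true (h4Free c a b d) x) 1 q else true) ≡ true
    at c a b d q with E′ c a b in cab | E′ c a d in cad | E′ c b d in cbd | E′ a b d in abd
    ... | true  | true  | true  | true  = refl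
    ... | true  | true  | false | _     = refl
    ... | true  | false | _     | _     = refl
    ... | false | _     | _     | _     = refl
    ... | true  | true  | true  | false = every-true _ (λ x _ → single x) 1 q
      where
      single : ∀ x → at1 true (h4Free c a b d) x ≡ true
      single []          = refl
      single (x ∷ [])    = trans (sym (h4Free-map c a b d x)) (H4-free (f c) (f a) (f b) (f d) (f x)
        (trans (h c a b) cab) (trans (h c a d) cad) (trans (h c b d) cbd) (trans (h a b d) abd))
      single (_ ∷ _ ∷ _) = refl
    noH4-at : ∀ c abd q → noH4At c abd q ≡ true
    noH4-at (c ∷ []) (a ∷ b ∷ d ∷ [])    q = at c a b d q
    noH4-at (_ ∷ []) []                  q = refl
    noH4-at (_ ∷ []) (_ ∷ [])            q = refl
    noH4-at (_ ∷ []) (_ ∷ _ ∷ [])        q = refl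
    noH4-at (_ ∷ []) (_ ∷ _ ∷ _ ∷ _ ∷ _) q = refl
    noH4-at []          _                q = refl
    noH4-at (_ ∷ _ ∷ _) _                q = refl

ExtensionBounded : S3 5 → S2 5 → List (Fin 5) → List (Fin 6) → Set
ExtensionBounded s l v₅ v₆ = Graph.isRep (E3 s) v₅ ≡ true → let open Graph (E3 (l , s)) in
  noI4 v₆ ≡ true → minimal (Graph.edges (E3 s) v₅) v₆ ≡ true → noH4 v₆ ≡ true → BoundedBy (E3 (l , s)) v₆

HasRep : S3 5 → List (Fin 5) → Set
HasRep s v = let open Graph (E3 s) in noI4 v ≡ true → noH4 v ≡ true → ∃ λ p → p ↭ v × isRep p ≡ true

-- The disjunction stops at the first success, so the quadratic forms are evaluated only for
-- admissible extensions. Vertex 0 is the new one and `e` stands for the edge count of the other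
-- five.
extensionOK : S3 5 → ℕ → S2 5 → Bool
extensionOK s e l = not (noI4 v) ∨ not (minimal e v) ∨ not (noH4 v)
                  ∨ (types v ℤ.+ pairs v ℤ.≤ᵇ costSum v)
  where
  open Graph (E3 (l , s))
  v = allFin 6

repOK : S3 5 → Bool
repOK s = not (isRep (allFin 5)) ∨ all2 5 (extensionOK s (edges (allFin 5)))
  where open Graph (E3 s)

repOK-sound : ∀ s → repOK s ≡ true → ∀ l → ExtensionBounded s l (allFin 5) (allFin 6)
repOK-sound s e l rep i m h = ℤ.≤ᵇ⇒≤ (subst T (sym (modus-ponens (modus-ponens (modus-ponens
  (all2-sound 5 (extensionOK s (Graph.edges (E3 s) (allFin 5))) (modus-ponens e rep) l) i) m) h)) _)

hasRep : S3 5 → Bool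
hasRep s = not (noI4 (allFin 5)) ∨ not (noH4 (allFin 5)) ∨ anyPerm isRep (allFin 5)
  where open Graph (E3 s)

hasRep-sound : ∀ s → hasRep s ≡ true → HasRep s (allFin 5)
hasRep-sound s e i h = anyPerm-sound (Graph.isRep (E3 s)) (allFin 5) (modus-ponens (modus-ponens e i) h)

-- The variables v₅ and v₆ for allFin 5 and allFin 6 keep the sums over their subsets from unfolding.
module Pointwise (v₅ : List (Fin 5)) (v₅≡ : v₅ ≡ allFin 5) (v₆ : List (Fin 6)) (v₆≡ : v₆ ≡ allFin 6)
  (extension-bounded : ∀ s l → ExtensionBounded s l v₅ v₆) (hasRep-holds : ∀ s → HasRep s v₅)
  {V : Set} (E : V → V → V → Bool)
  (s₁₂ : ∀ a b c → E a b c ≡ E b a c) (s₂₃ : ∀ a b c → E a b c ≡ E a c b)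
  (loops : ∀ a b → E a a b ≡ true)
  (I4-free : ∀ a b c d → E a b c ∨ E a b d ∨ E a c d ∨ E b c d ≡ true)
  (H4-free : ∀ c a b d x → E c a b ≡ true → E c a d ≡ true → E c b d ≡ true → E a b d ≡ false →
    Graph.h4Free E c a b d x ≡ true)
  where

  open Graph E
  open GraphInvariance E s₁₂ s₂₃

  module OnFin {n} (f : Fin n → V) where
    pull : Fin n → Fin n → Fin n → Bool
    pull i j k = E (f i) (f j) (f k)

    S : S3 n
    S = tab3 n pull

    pull-S : ∀ i j k → pull i j k ≡ E3 S i j k
    pull-S = E3-tab n pull (λ i k → loops (f i) (f k)) (λ i j k → s₁₂ (f i) (f j) (f k)) (λ i j k → s₂₃ (f i) (f j) (f k))

    open Pullback E (E3 S) f pull-S public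
    open PullbackFree E (E3 S) f pull-S I4-free H4-free public

  Bounded : List V → Set
  Bounded = BoundedBy E

  Bounded-↭ : ∀ {l l′} → l ↭ l′ → Bounded l → Bounded l′
  Bounded-↭ h = subst₂ ℤ._≤_ (cong₂ ℤ._+_ (types-invariant h) (pairs-invariant h)) (costSum-invariant h)

  findRep : ∀ r → length r ≡ 5 → ∃ λ r′ → r′ ↭ r × isRep r′ ≡ true
  findRep r@(_ ∷ _ ∷ _ ∷ _ ∷ _ ∷ []) refl = pullBack (hasRep-holds S (noI4-holds v₅) (noH4-holds v₅))
    where
    open OnFin (lookup r)
    pullBack : (∃ λ p → p ↭ v₅ × Graph.isRep (E3 S) p ≡ true) → ∃ λ r′ → r′ ↭ r × isRep r′ ≡ true
    pullBack (p , h , e) = map (lookup r) p , subst (map (lookup r) p ↭_) (cong (map (lookup r)) v₅≡) (↭-map⁺ (lookup r) h)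
      , trans (isRep-map p) e

  bounded-image : (f : Fin 6 → V) → let r = map (f ∘ suc) v₅ in
    isRep r ≡ true → minimal (edges r) (map f v₆) ≡ true → Bounded (map f v₆)
  bounded-image f rep min = P.bounded-map v₆ (extension-bounded s l
      (trans (sym (R.isRep-map v₅)) rep) (F.noI4-holds v₆)
      (trans (cong (λ e → Graph.minimal (E3 (l , s)) e v₆) (sym (R.edges-map v₅)))
        (trans (sym (P.minimal-map (edges (map (f ∘ suc) v₅)) v₆)) min))
      (F.noH4-holds v₆))
    where
    s = OnFin.S (f ∘ suc)
    -- By definition of `tab3` the second component of `OnFin.S f` is `s`, so `(l , s)` is the whole
    -- table of `f`.
    l = proj₁ (OnFin.S f)
    module R = Pullback E (E3 s) (f ∘ suc) (OnFin.pull-S (f ∘ suc))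
    module P = Pullback E (E3 (l , s)) f (OnFin.pull-S f)
    module F = PullbackFree E (E3 (l , s)) f (OnFin.pull-S f) I4-free H4-free

  bounded-rep : ∀ x r → length r ≡ 5 → isRep r ≡ true → minimal (edges r) (x ∷ r) ≡ true → Bounded (x ∷ r)
  bounded-rep x r@(_ ∷ _ ∷ _ ∷ _ ∷ _ ∷ []) refl =
    transport r (x ∷ r) (cong (map (f ∘ suc)) v₅≡) (cong (map f) v₆≡)
    where
    f = lookup (x ∷ r)
    transport : ∀ r l → map (f ∘ suc) v₅ ≡ r → map f v₆ ≡ l →
      isRep r ≡ true → minimal (edges r) l ≡ true → Bounded l
    transport _ _ refl refl = bounded-image f

  -- If the tail of a list does not have the fewest edges among its 5-subsets, restart from one that has
  -- fewer.
  bounded : ∀ l → length l ≡ 6 → Bounded l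
  bounded (x ∷ r) n = go x r (ℕ.suc-injective n) (ℕ.<-wellFounded (edges r))
    where
    contra : ∀ {b} {P : Set} → b ≡ false → T b → P
    contra refl ()

    go : ∀ x r → length r ≡ 5 → Acc ℕ._<_ (edges r) → Bounded (x ∷ r)

    smaller : ∀ {x r r′} → length r ≡ 5 → Acc ℕ._<_ (edges r) → r′ ↭ r →
      (∃₂ λ p q → length p ≡ 1 × p ++ q ↭ x ∷ r′ × (edges r′ ≤ᵇ edges q) ≡ false) → Bounded (x ∷ r)
    smaller {x} {r} n (acc rec) h (y ∷ [] , s , _ , h′ , e) =
      Bounded-↭ h″ (go y s (ℕ.suc-injective (trans (↭-length h″) (cong suc n)))
        (rec (subst (edges s ℕ.<_) (edges-invariant h) (ℕ.≰⇒> λ le → contra e (ℕ.≤⇒≤ᵇ le)))))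
      where
      h″ : y ∷ s ↭ x ∷ r
      h″ = ↭-trans h′ (prep x h)

    byMinimality : ∀ {x r r′} → length r ≡ 5 → Acc ℕ._<_ (edges r) → r′ ↭ r → isRep r′ ≡ true →
      ∀ b → minimal (edges r′) (x ∷ r′) ≡ b → Bounded (x ∷ r)
    byMinimality {x} {r′ = r′} n a h rep true min =
      Bounded-↭ (prep x h) (bounded-rep x r′ (trans (↭-length h) n) rep min)
    byMinimality {x} {r′ = r′} n a h rep false min = smaller n a h (every-false _ 1 (x ∷ r′) min)

    go x r n a = let r′ , h , rep = findRep r n in byMinimality n a h rep _ refl

-- Tuples of vertices of a given graph

S₀-I4 : S3 4
S₀-I4 = ((false , false , tt) , (false , tt) , tt , tt) , ((false , tt) , tt , tt) , (tt , tt) , tt , tt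

S₀-H4 : S3 5
S₀-H4 = ((true , true , false , tt) , (false , true , tt) , (false , tt) , tt , tt)
      , ((true , false , tt) , (false , tt) , tt , tt) , ((false , tt) , tt , tt) , (tt , tt) , tt , tt

module _ {k : ℕ} where

  Agrees : ThreeGraph k → S3 k → Set
  Agrees H S₀ = ∀ a b c → a ≢ b → b ≢ c → a ≢ c → edge H a b c ≡ E3 S₀ a b c

  -- A map identifying `a` and `b` makes `a b c` an edge of the closure for every `c`; a non-edge
  -- through each pair therefore forces injectivity.
  Separates : S3 k → Set
  Separates S₀ = ∀ a b → a ≡ b ⊎ ∃ λ c → E3 S₀ a b c ≡ false

agrees-I4 : Agrees I34 S₀-I4
agrees-I4 = toWitness {a? = Fin.all? λ a → Fin.all? λ b → Fin.all? λ c →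
  ¬? (a Fin.≟ b) →-dec ¬? (b Fin.≟ c) →-dec ¬? (a Fin.≟ c) →-dec (edge I34 a b c Bool.≟ E3 S₀-I4 a b c)} tt

agrees-H4 : Agrees H4 S₀-H4
agrees-H4 = toWitness {a? = Fin.all? λ a → Fin.all? λ b → Fin.all? λ c →
  ¬? (a Fin.≟ b) →-dec ¬? (b Fin.≟ c) →-dec ¬? (a Fin.≟ c) →-dec (edge H4 a b c Bool.≟ E3 S₀-H4 a b c)} tt

separates-I4 : Separates S₀-I4
separates-I4 = toWitness {a? = Fin.all? λ a → Fin.all? λ b →
  (a Fin.≟ b) ⊎-dec Fin.any? λ c → E3 S₀-I4 a b c Bool.≟ false} tt

separates-H4 : Separates S₀-H4
separates-H4 = toWitness {a? = Fin.all? λ a → Fin.all? λ b →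
  (a Fin.≟ b) ⊎-dec Fin.any? λ c → E3 S₀-H4 a b c Bool.≟ false} tt

_≐_ : ∀ {n} → Fin n → Fin n → Bool
a ≐ b = does (a Fin.≟ b)

≐-refl : ∀ {n} (a : Fin n) → (a ≐ a) ≡ true
≐-refl a = dec-true (a Fin.≟ a) refl

≐-sym : ∀ {n} (a b : Fin n) → (a ≐ b) ≡ (b ≐ a)
≐-sym a b with a Fin.≟ b
... | yes refl = sym (≐-refl a)
... | no a≢b   = sym (dec-false (b Fin.≟ a) (a≢b ∘ sym))

≢⇒≐ : ∀ {n} {a b : Fin n} → a ≢ b → (a ≐ b) ≡ false
≢⇒≐ {a = a} {b} = dec-false (a Fin.≟ b)

module Closure {n : ℕ} (G : ThreeGraph n) where

  -- Coinciding vertices behave like clones joined by all possible edges, which creates neither an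
  -- I₄ nor an H₄; hence tuples with repetitions need no separate treatment.
  E : Fin n → Fin n → Fin n → Bool
  E a b c = (a ≐ b) ∨ (b ≐ c) ∨ (a ≐ c) ∨ edge G a b c

  E-sym₁₂ : ∀ a b c → E a b c ≡ E b a c
  E-sym₁₂ a b c rewrite ≐-sym b a | sym₁₂ G b a c with a ≐ b | b ≐ c | a ≐ c
  ... | true  | _     | _     = refl
  ... | false | true  | true  = refl
  ... | false | true  | false = refl
  ... | false | false | true  = refl
  ... | false | false | false = refl

  E-sym₂₃ : ∀ a b c → E a b c ≡ E a c b
  E-sym₂₃ a b c rewrite ≐-sym c b | sym₂₃ G a c b with a ≐ b | b ≐ c | a ≐ c
  ... | true  | true  | true  = refl
  ... | true  | true  | false = refl
  ... | true  | false | true  = refl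
  ... | true  | false | false = refl
  ... | false | true  | true  = refl
  ... | false | true  | false = refl
  ... | false | false | true  = refl
  ... | false | false | false = refl

  E-loops : ∀ a b → E a a b ≡ true
  E-loops a b rewrite ≐-refl a = refl

  E-distinct : ∀ {a b c} → a ≢ b → b ≢ c → a ≢ c → E a b c ≡ edge G a b c
  E-distinct p q r rewrite ≢⇒≐ p | ≢⇒≐ q | ≢⇒≐ r = refl

  module _ {k} (f : Fin k → Fin n) where

    pull : Fin k → Fin k → Fin k → Bool
    pull i j l = E (f i) (f j) (f l)

    embed : ∀ H S₀ → Agrees H S₀ → Separates S₀ → tab3 k pull ≡ S₀ → InducedSub H G
    embed H S₀ agrees separates e = f , injective , induced
      where
      pull≡ : ∀ a b c → pull a b c ≡ E3 S₀ a b c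
      pull≡ a b c = trans (E3-tab k pull (λ i l → E-loops (f i) (f l)) (λ i j l → E-sym₁₂ (f i) (f j) (f l))
        (λ i j l → E-sym₂₃ (f i) (f j) (f l)) a b c) (cong (λ S → E3 S a b c) e)
      injective : ∀ a b → f a ≡ f b → a ≡ b
      injective a b fa≡fb with separates a b
      ... | inj₁ a≡b     = a≡b
      ... | inj₂ (c , z) with () ← trans (sym (E-loops (f b) (f c)))
                                     (trans (cong (λ v → E v (f b) (f c)) (sym fa≡fb)) (trans (pull≡ a b c) z))
      induced : ∀ a b c → a ≢ b → b ≢ c → a ≢ c → edge H a b c ≡ edge G (f a) (f b) (f c)
      induced a b c p q r = trans (agrees a b c p q r) (trans (sym (pull≡ a b c))
        (E-distinct (p ∘ injective a b) (q ∘ injective b c) (r ∘ injective a c)))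

  module _ (free : Free G) where

    I4-free : ∀ a b c d → E a b c ∨ E a b d ∨ E a c d ∨ E b c d ≡ true
    I4-free a b c d with E a b c in abc | E a b d in abd | E a c d in acd | E b c d in bcd
    ... | true  | _     | _     | _     = refl
    ... | false | true  | _     | _     = refl
    ... | false | false | true  | _     = refl
    ... | false | false | false | true  = refl
    ... | false | false | false | false = contradiction (embed f I34 S₀-I4 agrees-I4 separates-I4 tab) (proj₁ free)
      where
      f = lookup (a ∷ b ∷ c ∷ d ∷ [])
      tab : tab3 4 (pull f) ≡ S₀-I4
      tab rewrite abc | abd | acd | bcd = refl

    -- Vertices in the order of H4: the four-edge pattern is 012, 013, 123, 024.
    no-H4 : ∀ a c b d x → E c a b ≡ true → E c a d ≡ true → E c b d ≡ true → E a b d ≡ false →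
      E c a x ≡ false → E c b x ≡ false → E c d x ≡ false →
      E a b x ≡ true → E a d x ≡ false → E b d x ≡ false → ⊥
    no-H4 a c b d x cab cad cbd abd cax cbx cdx abx adx bdx =
      proj₂ free (embed f H4 S₀-H4 agrees-H4 separates-H4 tab)
      where
      f = lookup (a ∷ c ∷ b ∷ d ∷ x ∷ [])
      tab : tab3 5 (pull f) ≡ S₀-H4
      tab rewrite E-sym₁₂ a c b | E-sym₁₂ a c d | E-sym₁₂ a c x
                | cab | cad | cax | abd | abx | adx | cbd | cbx | cdx | bdx = refl

    H4-free : ∀ c a b d x → E c a b ≡ true → E c a d ≡ true → E c b d ≡ true → E a b d ≡ false →
      Graph.h4Free E c a b d x ≡ true
    H4-free c a b d x cab cad cbd abd
      with E c a x in cax | E c b x in cbx | E c d x in cdx | E a b x in abx | E a d x in adx | E b d x in bdx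
    ... | true  | _     | _     | _     | _     | _     = refl
    ... | false | true  | _     | _     | _     | _     = refl
    ... | false | false | true  | _     | _     | _     = refl
    ... | false | false | false | true  | true  | _     = refl
    ... | false | false | false | true  | false | true  = refl
    ... | false | false | false | false | true  | true  = refl
    ... | false | false | false | false | false | false = refl
    -- In the three remaining cases the one edge at `x` misses `d`, `b` and `a` respectively; the
    -- missed vertex takes the fourth place of H₄.
    ... | false | false | false | true  | false | false =
      contradiction (no-H4 a c b d x cab cad cbd abd cax cbx cdx abx adx bdx) λ ()
    ... | false | false | false | false | true  | false =
      contradiction (no-H4 a c d b x cad cab (trans (E-sym₂₃ c d b) cbd) (trans (E-sym₂₃ a d b) abd)
        cax cdx cbx adx abx (trans (E-sym₁₂ d b x) bdx)) λ ()
    ... | false | false | false | false | false | true  =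
      contradiction (no-H4 b c d a x cbd (trans (E-sym₂₃ c b a) cab) (trans (E-sym₂₃ c d a) cad)
        (trans (E-sym₂₃ b d a) (trans (E-sym₁₂ b a d) abd)) cbx cdx cax bdx
        (trans (E-sym₁₂ b a x) abx) (trans (E-sym₁₂ d a x) adx)) λ ()

-- Counting edges by ordered triples

module ∑ℕ = SemiringSum ℕ.+-*-semiring

∑-mono : ∀ {n} {f g : Fin n → ℕ} → (∀ i → f i ℕ.≤ g i) → ∑ℕ.sum f ℕ.≤ ∑ℕ.sum g
∑-mono {zero}  h = ℕ.z≤n
∑-mono {suc n} h = ℕ.+-mono-≤ (h zero) (∑-mono (h ∘ suc))

∑-const : ∀ n c → ∑ℕ.sum {n} (λ _ → c) ≡ n ℕ.* c
∑-const zero    c = refl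
∑-const (suc n) c = cong (c ℕ.+_) (∑-const n c)

pos-∑ : ∀ {n} (f : Fin n → ℕ) → sum (λ i → + f i) ≡ + ∑ℕ.sum f
pos-∑ {zero}  f = refl
pos-∑ {suc n} f = cong (ℤ._+_ (+ f zero)) (pos-∑ (f ∘ suc))

module _ {n : ℕ} where

  ∑³ : (Fin n → Fin n → Fin n → ℕ) → ℕ
  ∑³ F = ∑ℕ.sum λ a → ∑ℕ.sum λ b → ∑ℕ.sum λ c → F a b c

  ∑³-cong : ∀ {F G} → (∀ a b c → F a b c ≡ G a b c) → ∑³ F ≡ ∑³ G
  ∑³-cong h = ∑ℕ.sum-cong-≗ λ a → ∑ℕ.sum-cong-≗ λ b → ∑ℕ.sum-cong-≗ λ c → h a b c

  ∑³-mono : ∀ {F G} → (∀ a b c → F a b c ℕ.≤ G a b c) → ∑³ F ℕ.≤ ∑³ G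
  ∑³-mono h = ∑-mono λ a → ∑-mono λ b → ∑-mono λ c → h a b c

  ∑³-+ : ∀ F G → ∑³ (λ a b c → F a b c ℕ.+ G a b c) ≡ ∑³ F ℕ.+ ∑³ G
  ∑³-+ F G = trans (∑ℕ.sum-cong-≗ λ a → trans (∑ℕ.sum-cong-≗ λ b → ∑ℕ.∑-distrib-+ (F a b) (G a b))
      (∑ℕ.∑-distrib-+ (λ b → ∑ℕ.sum (F a b)) (λ b → ∑ℕ.sum (G a b))))
    (∑ℕ.∑-distrib-+ (λ a → ∑ℕ.sum λ b → ∑ℕ.sum (F a b)) (λ a → ∑ℕ.sum λ b → ∑ℕ.sum (G a b)))

  ∑³-swap₁₂ : ∀ F → ∑³ (λ a b c → F b a c) ≡ ∑³ F
  ∑³-swap₁₂ F = ∑ℕ.∑-comm (λ a b → ∑ℕ.sum (F b a))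

  ∑³-swap₂₃ : ∀ F → ∑³ (λ a b c → F a c b) ≡ ∑³ F
  ∑³-swap₂₃ F = ∑ℕ.sum-cong-≗ λ a → ∑ℕ.∑-comm (λ b c → F a c b)

  ∑³-const : ∀ k → ∑³ (λ _ _ _ → k) ≡ n ℕ.* (n ℕ.* (n ℕ.* k))
  ∑³-const k = trans (∑ℕ.sum-cong-≗ {n} λ _ → trans (∑ℕ.sum-cong-≗ {n} λ _ → ∑-const n k) (∑-const n (n ℕ.* k)))
    (∑-const n (n ℕ.* (n ℕ.* k)))

  pos-∑³ : ∀ F → sum (λ a → sum λ b → sum λ c → + F a b c) ≡ + ∑³ F
  pos-∑³ F = trans (sum-cong-≗ λ a → trans (sum-cong-≗ λ b → pos-∑ (F a b)) (pos-∑ λ b → ∑ℕ.sum (F a b)))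
    (pos-∑ λ a → ∑ℕ.sum λ b → ∑ℕ.sum (F a b))

_≺_ : ∀ {n} → Fin n → Fin n → Bool
a ≺ b = isYes (a Fin.<? b)

sum-concatMap : ∀ {m} (F : A → List ℕ) (g : Fin m → A) →
  ListAction.sum (concatMap F (tabulate g)) ≡ ∑ℕ.sum (λ i → ListAction.sum (F (g i)))
sum-concatMap {m = zero}  F g = refl
sum-concatMap {m = suc m} F g = trans (ListAction.sum-++ (F (g zero)) _)
  (cong (ListAction.sum (F (g zero)) ℕ.+_) (sum-concatMap F (g ∘ suc)))

sum-map : ∀ {m} (F : A → ℕ) (g : Fin m → A) → ListAction.sum (map F (tabulate g)) ≡ ∑ℕ.sum (λ i → F (g i))
sum-map {m = zero}  F g = refl
sum-map {m = suc m} F g = cong (F (g zero) ℕ.+_) (sum-map F (g ∘ suc))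

sum-triples : ∀ {n} (F : Fin n → Fin n → Fin n → ℕ) →
  ListAction.sum (concatMap (λ i → concatMap (λ j → map (λ k → F i j k) (allFin n)) (allFin n)) (allFin n)) ≡ ∑³ F
sum-triples {n} F = trans (sum-concatMap (λ i → concatMap (λ j → map (λ k → F i j k) (allFin n)) (allFin n)) (λ i → i))
  (∑ℕ.sum-cong-≗ λ i → trans (sum-concatMap (λ j → map (λ k → F i j k) (allFin n)) (λ j → j))
    (∑ℕ.sum-cong-≗ λ j → sum-map (F i j) (λ k → k)))

module EdgeCount {n : ℕ} (G : ThreeGraph n) where

  -- The summand of numEdges is a local definition of Defs; unification recovers it.
  summand : Σ (Fin n → Fin n → Fin n → ℕ) λ F → numEdges G ≡
    ListAction.sum (concatMap (λ i → concatMap (λ j → map (λ k → F i j k) (allFin n)) (allFin n)) (allFin n))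
  summand = _ , refl

  increasing : Fin n → Fin n → Fin n → ℕ
  increasing a b c = ind ((a ≺ b) ∧ (b ≺ c) ∧ edge G a b c)

  summand≡ : ∀ a b c → proj₁ summand a b c ≡ increasing a b c
  summand≡ a b c with a Fin.<? b | b Fin.<? c | edge G a b c
  ... | yes _ | yes _ | true  = refl
  ... | yes _ | yes _ | false = refl
  ... | yes _ | no  _ | true  = refl
  ... | yes _ | no  _ | false = refl
  ... | no  _ | yes _ | true  = refl
  ... | no  _ | yes _ | false = refl
  ... | no  _ | no  _ | true  = refl
  ... | no  _ | no  _ | false = refl

  numEdges≡ : numEdges G ≡ ∑³ increasing
  numEdges≡ = trans (proj₂ summand) (trans (sum-triples (proj₁ summand)) (∑³-cong summand≡))

  -- Exactly one of the six orders of three distinct vertices is increasing, so this is the edge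
  -- indicator on distinct triples and zero elsewhere.
  orders : Fin n → Fin n → Fin n → ℕ
  orders a b c = increasing a b c ℕ.+ (increasing a c b ℕ.+ (increasing b a c ℕ.+
    (increasing b c a ℕ.+ (increasing c a b ℕ.+ increasing c b a))))

  ∑-orders : ∑³ orders ≡ 6 ℕ.* numEdges G
  ∑-orders rewrite numEdges≡ = begin
    ∑³ orders
      ≡⟨ ∑³-+ I _ ⟩
    ∑³ I ℕ.+ _
      ≡⟨ cong (∑³ I ℕ.+_) (step acb _ (∑³-swap₂₃ I) (step bac _ (∑³-swap₁₂ I) (step bca _ eq-bca
           (step cab _ eq-cab eq-cba)))) ⟩
    ∑³ I ℕ.+ (∑³ I ℕ.+ (∑³ I ℕ.+ (∑³ I ℕ.+ (∑³ I ℕ.+ ∑³ I))))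
      ≡⟨ cong (λ x → ∑³ I ℕ.+ (∑³ I ℕ.+ (∑³ I ℕ.+ (∑³ I ℕ.+ (∑³ I ℕ.+ x))))) (ℕ.+-identityʳ (∑³ I)) ⟨
    6 ℕ.* ∑³ I ∎
    where
    open ≡-Reasoning
    I = increasing
    acb bac bca cab cba : Fin n → Fin n → Fin n → ℕ
    acb a b c = I a c b
    bac a b c = I b a c
    bca a b c = I b c a
    cab a b c = I c a b
    cba a b c = I c b a
    eq-bca : ∑³ bca ≡ ∑³ I
    eq-bca = trans (∑³-swap₁₂ acb) (∑³-swap₂₃ I)
    eq-cab : ∑³ cab ≡ ∑³ I
    eq-cab = trans (∑³-swap₂₃ bac) (∑³-swap₁₂ I)
    eq-cba : ∑³ cba ≡ ∑³ I
    eq-cba = trans (∑³-swap₁₂ cab) eq-cab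
    step : ∀ F H {x y} → ∑³ F ≡ x → ∑³ H ≡ y → ∑³ (λ a b c → F a b c ℕ.+ H a b c) ≡ x ℕ.+ y
    step F H refl refl = ∑³-+ F H

  Coincide : Fin n → Fin n → Fin n → Set
  Coincide a b c = a ≡ b ⊎ b ≡ c ⊎ a ≡ c

  increasing-zero : ∀ a b c → ¬ (a Fin.< b × b Fin.< c) → increasing a b c ≡ 0
  increasing-zero a b c h with a Fin.<? b | b Fin.<? c
  ... | yes p | yes q = contradiction (p , q) h
  ... | yes _ | no  _ = refl
  ... | no  _ | _     = refl

  increasing-edge : ∀ a b c → a Fin.< b → b Fin.< c → increasing a b c ≡ ind (edge G a b c)
  increasing-edge a b c p q with a Fin.<? b | b Fin.<? c
  ... | yes _ | yes _ = refl
  ... | yes _ | no ¬q = contradiction q ¬q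
  ... | no ¬p | _     = contradiction p ¬p

  increasing-coincide : ∀ {a b c} → Coincide a b c → increasing a b c ≡ 0
  increasing-coincide {a} {b} {c} (inj₁ refl)        = increasing-zero a b c λ (p , _) → ℕ.<-irrefl refl p
  increasing-coincide {a} {b} {c} (inj₂ (inj₁ refl)) = increasing-zero a b c λ (_ , q) → ℕ.<-irrefl refl q
  increasing-coincide {a} {b} {c} (inj₂ (inj₂ refl)) = increasing-zero a b c λ (p , q) → ℕ.<-asym p q

  coincide-acb : ∀ {a b c} → Coincide a b c → Coincide a c b
  coincide-acb (inj₁ p)        = inj₂ (inj₂ p)
  coincide-acb (inj₂ (inj₁ p)) = inj₂ (inj₁ (sym p))
  coincide-acb (inj₂ (inj₂ p)) = inj₁ p

  coincide-bac : ∀ {a b c} → Coincide a b c → Coincide b a c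
  coincide-bac (inj₁ p)        = inj₁ (sym p)
  coincide-bac (inj₂ (inj₁ p)) = inj₂ (inj₂ p)
  coincide-bac (inj₂ (inj₂ p)) = inj₂ (inj₁ p)

  orders-coincide : ∀ {a b c} → Coincide a b c → orders a b c ≡ 0
  orders-coincide abc = zero₆ (increasing-coincide abc) (increasing-coincide (coincide-acb abc))
      (increasing-coincide bac) (increasing-coincide (coincide-acb bac))
      (increasing-coincide cab) (increasing-coincide (coincide-acb cab))
    where
    bac = coincide-bac abc
    cab = coincide-bac (coincide-acb abc)
    zero₆ : ∀ {u v w x y z} → u ≡ 0 → v ≡ 0 → w ≡ 0 → x ≡ 0 → y ≡ 0 → z ≡ 0 →
      u ℕ.+ (v ℕ.+ (w ℕ.+ (x ℕ.+ (y ℕ.+ z)))) ≡ 0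
    zero₆ refl refl refl refl refl refl = refl

  sorted-others : ∀ x y z → x Fin.< y → y Fin.< z →
    increasing x z y ≡ 0 × increasing y x z ≡ 0 × increasing y z x ≡ 0 × increasing z x y ≡ 0 × increasing z y x ≡ 0
  sorted-others x y z p q =
      increasing-zero x z y (λ (_ , r) → ℕ.<-asym q r) , increasing-zero y x z (λ (r , _) → ℕ.<-asym p r)
    , increasing-zero y z x (λ (_ , r) → ℕ.<-asym (ℕ.<-trans p q) r)
    , increasing-zero z x y (λ (r , _) → ℕ.<-asym (ℕ.<-trans p q) r)
    , increasing-zero z y x (λ (r , _) → ℕ.<-asym q r)

  orders-distinct : ∀ a b c → Coincide a b c ⊎ orders a b c ≡ ind (edge G a b c)
  orders-distinct a b c with Fin.<-cmp a b | Fin.<-cmp b c | Fin.<-cmp a c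
  ... | tri≈ _ p _ | _          | _          = inj₁ (inj₁ p)
  ... | _          | tri≈ _ q _ | _          = inj₁ (inj₂ (inj₁ q))
  ... | _          | _          | tri≈ _ r _ = inj₁ (inj₂ (inj₂ r))
  ... | tri< p _ _ | tri< q _ _ | _          = inj₂ abc
    where
    abc : orders a b c ≡ ind (edge G a b c)
    abc with e₁ , e₂ , e₃ , e₄ , e₅ ← sorted-others a b c p q
      rewrite increasing-edge a b c p q | e₁ | e₂ | e₃ | e₄ | e₅ = ℕ.+-identityʳ _
  ... | tri< p _ _ | tri> _ _ q | tri< r _ _ = inj₂ acb
    where
    acb : orders a b c ≡ ind (edge G a b c)
    acb with e₁ , e₂ , e₃ , e₄ , e₅ ← sorted-others a c b r q
      rewrite sym₂₃ G a b c | increasing-edge a c b r q | e₁ | e₂ | e₃ | e₄ | e₅ = ℕ.+-identityʳ _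
  ... | tri< p _ _ | tri> _ _ q | tri> _ _ r = inj₂ cab
    where
    cab : orders a b c ≡ ind (edge G a b c)
    cab with e₁ , e₂ , e₃ , e₄ , e₅ ← sorted-others c a b r p
      rewrite sym₂₃ G a b c | sym₁₂ G a c b | increasing-edge c a b r p | e₁ | e₂ | e₃ | e₄ | e₅ = ℕ.+-identityʳ _
  ... | tri> _ _ p | tri< q _ _ | tri< r _ _ = inj₂ bac
    where
    bac : orders a b c ≡ ind (edge G a b c)
    bac with e₁ , e₂ , e₃ , e₄ , e₅ ← sorted-others b a c p r
      rewrite sym₁₂ G a b c | increasing-edge b a c p r | e₁ | e₂ | e₃ | e₄ | e₅ = ℕ.+-identityʳ _
  ... | tri> _ _ p | tri< q _ _ | tri> _ _ r = inj₂ bca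
    where
    bca : orders a b c ≡ ind (edge G a b c)
    bca with e₁ , e₂ , e₃ , e₄ , e₅ ← sorted-others b c a q r
      rewrite sym₁₂ G a b c | sym₂₃ G b a c | increasing-edge b c a q r | e₁ | e₂ | e₃ | e₄ | e₅ = ℕ.+-identityʳ _
  ... | tri> _ _ p | tri> _ _ q | _          = inj₂ cba
    where
    cba : orders a b c ≡ ind (edge G a b c)
    cba with e₁ , e₂ , e₃ , e₄ , e₅ ← sorted-others c b a q p
      rewrite sym₁₂ G a b c | sym₂₃ G b a c | sym₁₂ G b c a | increasing-edge c b a q p | e₁ | e₂ | e₃ | e₄ | e₅ = refl

  orders≤edge : ∀ a b c → orders a b c ℕ.≤ ind (edge G a b c)
  orders≤edge a b c with orders-distinct a b c
  ... | inj₁ h = subst (ℕ._≤ ind (edge G a b c)) (sym (orders-coincide h)) ℕ.z≤n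
  ... | inj₂ e = ℕ.≤-reflexive e

∑³-* : ∀ {n} k (F : Fin n → Fin n → Fin n → ℕ) → ∑³ (λ a b c → k ℕ.* F a b c) ≡ k ℕ.* ∑³ F
∑³-* k F = trans (∑ℕ.sum-cong-≗ λ a → trans (∑ℕ.sum-cong-≗ λ b → sym (∑ℕ.*-distribˡ-sum k (F a b)))
    (sym (∑ℕ.*-distribˡ-sum k λ b → ∑ℕ.sum (F a b))))
  (sym (∑ℕ.*-distribˡ-sum k λ a → ∑ℕ.sum λ b → ∑ℕ.sum (F a b)))

∑-≐ : ∀ {n} (a : Fin n) → ∑ℕ.sum (λ b → ind (a ≐ b)) ≡ 1
∑-≐ {suc n} zero    = cong suc (trans (∑-const n 0) (ℕ.*-zeroʳ n))
∑-≐ {suc n} (suc a) = ∑-≐ a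

module _ {n : ℕ} where

  ∑³-bc : ∑³ (λ (a b c : Fin n) → ind (b ≐ c)) ≡ n ℕ.* n
  ∑³-bc = trans (∑ℕ.sum-cong-≗ {n} {y = λ _ → n} λ a → diagonal) (∑-const n n)
    where
    diagonal : ∑ℕ.sum (λ (b : Fin n) → ∑ℕ.sum λ c → ind (b ≐ c)) ≡ n
    diagonal = trans (∑ℕ.sum-cong-≗ {n} {y = λ _ → 1} ∑-≐) (trans (∑-const n 1) (ℕ.*-identityʳ n))

  ∑³-ac : ∑³ (λ (a b c : Fin n) → ind (a ≐ c)) ≡ n ℕ.* n
  ∑³-ac = trans (∑³-swap₁₂ (λ (a b c : Fin n) → ind (b ≐ c))) ∑³-bc

  ∑³-ab : ∑³ (λ (a b c : Fin n) → ind (a ≐ b)) ≡ n ℕ.* n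
  ∑³-ab = trans (∑³-swap₂₃ (λ (a b c : Fin n) → ind (a ≐ c))) ∑³-ac

-- The lower bound on the number of edges

module LowerBound
  (v₅ : List (Fin 5)) (v₅≡ : v₅ ≡ allFin 5) (v₆ : List (Fin 6)) (v₆≡ : v₆ ≡ allFin 6)
  (extension-bounded : ∀ s l → ExtensionBounded s l v₅ v₆) (hasRep-holds : ∀ s → HasRep s v₅)
  {n : ℕ} (G : ThreeGraph n) (free : Free G) where

  open Closure G
  open EdgeCount G
  open Graph E using (costAt; costSum; types; pairs; cost)
  open GraphSums E
  open Pointwise v₅ v₅≡ v₆ v₆≡ extension-bounded hasRep-holds E E-sym₁₂ E-sym₂₃ E-loops
    (I4-free free) (H4-free free) using (bounded)

  costSum-nonneg : 0ℤ ℤ.≤ sumLists 6 costSum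
  costSum-nonneg = subst (0ℤ ℤ.≤_) (sym split)
    (ℤ.+-mono-≤ (ℤ.+-mono-≤ types-nonneg pairs-nonneg) (sumLists-nonneg {n} 6 slack λ l e → ℤ.i≤j⇒0≤j-i (bounded l e)))
    where
    slack : List (Fin n) → ℤ
    slack l = costSum l ℤ.- (types l ℤ.+ pairs l)
    cancel : ∀ x y → x ≡ y ℤ.+ (x ℤ.- y)
    cancel x y = sym (trans (ℤ.+-comm y (x ℤ.- y)) (trans (ℤ.+-assoc x (ℤ.- y) y)
      (trans (cong (ℤ._+_ x) (ℤ.+-inverseˡ y)) (ℤ.+-identityʳ x))))
    split : sumLists 6 costSum ≡ (sumLists 6 types ℤ.+ sumLists 6 pairs) ℤ.+ sumLists 6 slack
    split = trans (sumLists-cong {n} 6 λ l → cancel (costSum l) (types l ℤ.+ pairs l))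
      (trans (sumLists-+ {n} 6 (λ l → types l ℤ.+ pairs l) slack)
        (cong (ℤ._+ sumLists 6 slack) (sumLists-+ {n} 6 types pairs)))

  -- With at least one vertex, the factors 20 and n³ in `costSum-sum` are positive and cancel.
  totalCost-nonneg : ∀ k → n ≡ suc k → 0ℤ ℤ.≤ sumLists 3 costAt
  totalCost-nonneg k refl = ℤ.*-cancelʳ-≤-pos 0ℤ (sumLists 3 costAt) cube
    {{ℤ.positive (ℤ.+<+ (ℕ.s≤s ℕ.z≤n))}} (subst (λ z → 0ℤ ℤ.≤ sumLists 3 costAt ℤ.* z) cube≡
      (ℤ.*-cancelˡ-≤-pos 0ℤ _ (+ 20) (subst (0ℤ ℤ.≤_) costSum-sum costSum-nonneg)))
    where
    cube = + (n ℕ.* (n ℕ.* (n ℕ.* 1)))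
    cube≡ : sumLists {n} 3 (λ _ → + 1) ≡ cube
    cube≡ = trans (pos-∑³ {n} (λ _ _ _ → 1)) (cong +_ (∑³-const {n} 1))

  -- Adding `u` to every cost leaves a multiple of the edge indicator, which moves the comparison to
  -- natural numbers.
  shifted : ∀ u v → (∀ b → cost b ℤ.+ + u ≡ + (v ℕ.* ind b)) →
    sumLists 3 costAt ℤ.+ + (n ℕ.* (n ℕ.* (n ℕ.* u))) ≡ + (v ℕ.* ∑³ (λ a b c → ind (E a b c)))
  shifted u v cost-shift = begin
    sumLists 3 costAt ℤ.+ + (n ℕ.* (n ℕ.* (n ℕ.* u)))
      ≡⟨ cong (ℤ._+_ (sumLists 3 costAt)) (trans (cong +_ (sym (∑³-const {n} u))) (sym (pos-∑³ {n} (λ _ _ _ → u)))) ⟩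
    sumLists 3 costAt ℤ.+ sumLists {n} 3 (λ _ → + u)
      ≡⟨ sumLists-+ {n} 3 costAt (λ _ → + u) ⟨
    sum (λ a → sum λ b → sum λ c → cost (E a b c) ℤ.+ + u)
      ≡⟨ sum-cong-≗ (λ a → sum-cong-≗ λ b → sum-cong-≗ λ c → cost-shift (E a b c)) ⟩
    sum (λ a → sum λ b → sum λ c → + (v ℕ.* ind (E a b c)))
      ≡⟨ pos-∑³ (λ a b c → v ℕ.* ind (E a b c)) ⟩
    + ∑³ (λ a b c → v ℕ.* ind (E a b c))
      ≡⟨ cong +_ (∑³-* v (λ a b c → ind (E a b c))) ⟩
    + (v ℕ.* ∑³ (λ a b c → ind (E a b c))) ∎
    where open ≡-Reasoning

  triples-bound : ∀ k → n ≡ suc k → 4 ℕ.* (n ℕ.* (n ℕ.* n)) ℕ.≤ 9 ℕ.* ∑³ (λ a b c → ind (E a b c))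
  -- 25056 = 4 · 6264 offsets the negative cost and 56376 = 9 · 6264 is the gap between the two
  -- costs. The solver sees `q` as a variable instead of a numeral, and `q` cancels.
  triples-bound k n≡ = bound 6264 25056 56376 refl refl λ { true → refl ; false → refl }
    where
    open +-*-Solver
    bound : ∀ q u v .{{_ : ℕ.NonZero q}} → u ≡ q ℕ.* 4 → v ≡ q ℕ.* 9 →
      (∀ b → cost b ℤ.+ + u ≡ + (v ℕ.* ind b)) → 4 ℕ.* (n ℕ.* (n ℕ.* n)) ℕ.≤ 9 ℕ.* ∑³ (λ a b c → ind (E a b c))
    divide : ∀ q u v {S} .{{_ : ℕ.NonZero q}} → u ≡ q ℕ.* 4 → v ≡ q ℕ.* 9 →
      n ℕ.* (n ℕ.* (n ℕ.* u)) ℕ.≤ v ℕ.* S → 4 ℕ.* (n ℕ.* (n ℕ.* n)) ℕ.≤ 9 ℕ.* S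
    divide q _ _ {S} refl refl h = ℕ.*-cancelˡ-≤ q (subst₂ ℕ._≤_
      (solve 2 (λ n q → n :* (n :* (n :* (q :* con 4))) := q :* (con 4 :* (n :* (n :* n)))) refl n q)
      (ℕ.*-assoc q 9 S) h)
    bound q u v u≡ v≡ cost-shift = divide q u v u≡ v≡ (ℤ.drop‿+≤+ (subst₂ ℤ._≤_
      (ℤ.+-identityˡ _) (shifted u v cost-shift) (ℤ.+-monoˡ-≤ _ (totalCost-nonneg k n≡))))

  -- Passing from `E` to the edges of `G` costs the triples with a coincidence, in total n² for each
  -- of the three equalities.
  E≤orders : ∀ a b c → ind (E a b c) ℕ.≤ orders a b c ℕ.+ (ind (a ≐ b) ℕ.+ (ind (b ≐ c) ℕ.+ ind (a ≐ c)))
  E≤orders a b c = bool (a ≐ b) (b ≐ c) (a ≐ c) (distinct (orders-distinct a b c))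
    where
    distinct : Coincide a b c ⊎ orders a b c ≡ ind (edge G a b c) →
      (a ≐ b) ≡ true ⊎ (b ≐ c) ≡ true ⊎ (a ≐ c) ≡ true ⊎ ind (edge G a b c) ≡ orders a b c
    distinct (inj₁ (inj₁ p))        = inj₁ (dec-true (a Fin.≟ b) p)
    distinct (inj₁ (inj₂ (inj₁ p))) = inj₂ (inj₁ (dec-true (b Fin.≟ c) p))
    distinct (inj₁ (inj₂ (inj₂ p))) = inj₂ (inj₂ (inj₁ (dec-true (a Fin.≟ c) p)))
    distinct (inj₂ e)               = inj₂ (inj₂ (inj₂ (sym e)))
    bool : ∀ p q r {e o} → p ≡ true ⊎ q ≡ true ⊎ r ≡ true ⊎ ind e ≡ o →
      ind (p ∨ q ∨ r ∨ e) ℕ.≤ o ℕ.+ (ind p ℕ.+ (ind q ℕ.+ ind r))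
    bool true  q     r     h = ℕ.≤-trans (ℕ.s≤s ℕ.z≤n) (ℕ.m≤n+m _ _)
    bool false true  r     h = ℕ.≤-trans (ℕ.s≤s ℕ.z≤n) (ℕ.m≤n+m _ _)
    bool false false true  h = ℕ.m≤n+m _ _
    bool false false false (inj₂ (inj₂ (inj₂ e))) = ℕ.≤-trans (ℕ.≤-reflexive e) (ℕ.m≤m+n _ 0)

  lowerBound : 4 ℕ.* (n ℕ.* (n ℕ.* n)) ℕ.≤ 9 ℕ.* (6 ℕ.* numEdges G ℕ.+ 3 ℕ.* (n ℕ.* n))
  lowerBound = byCases n refl
    where
    total : ∑³ (λ a b c → orders a b c ℕ.+ (ind (a ≐ b) ℕ.+ (ind (b ≐ c) ℕ.+ ind (a ≐ c))))
      ≡ 6 ℕ.* numEdges G ℕ.+ 3 ℕ.* (n ℕ.* n)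
    total = trans (∑³-+ orders _) (cong₂ ℕ._+_ ∑-orders (trans (∑³-+ {n} (λ a b c → ind (a ≐ b)) (λ a b c → ind (b ≐ c) ℕ.+ ind (a ≐ c)))
      (cong₂ ℕ._+_ (∑³-ab {n}) (trans (∑³-+ {n} (λ a b c → ind (b ≐ c)) (λ a b c → ind (a ≐ c)))
        (cong₂ ℕ._+_ (∑³-bc {n}) (trans (∑³-ac {n}) (sym (ℕ.+-identityʳ (n ℕ.* n)))))))))
    byCases : ∀ k → n ≡ k → 4 ℕ.* (n ℕ.* (n ℕ.* n)) ℕ.≤ 9 ℕ.* (6 ℕ.* numEdges G ℕ.+ 3 ℕ.* (n ℕ.* n))
    byCases zero    refl = ℕ.z≤n
    byCases (suc k) n≡   = ℕ.≤-trans (triples-bound k n≡)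
      (ℕ.*-monoʳ-≤ 9 (ℕ.≤-trans (∑³-mono E≤orders) (ℕ.≤-reflexive total)))

-- Turán's construction

next : Fin 3 → Fin 3
next 0F = 1F
next 1F = 2F
next 2F = 0F

-- The edges are the triples inside a colour class and those with two vertices in a class and the third
-- one in the next class.
tri : Fin 3 → Fin 3 → Fin 3 → Bool
tri x y z = ((x ≐ y) ∧ ((y ≐ z) ∨ (next y ≐ z))) ∨ ((y ≐ z) ∧ (next y ≐ x)) ∨ ((x ≐ z) ∧ (next z ≐ y))

tri-sym₁₂ : ∀ x y z → tri x y z ≡ tri y x z
tri-sym₁₂ = toWitness {a? = Fin.all? λ x → Fin.all? λ y → Fin.all? λ z → tri x y z Bool.≟ tri y x z} tt

tri-sym₂₃ : ∀ x y z → tri x y z ≡ tri x z y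
tri-sym₂₃ = toWitness {a? = Fin.all? λ x → Fin.all? λ y → Fin.all? λ z → tri x y z Bool.≟ tri x z y} tt

-- Edges depend on colours alone, so freeness reduces to finitely many colourings of four and of
-- five vertices, repeated colours included.
tri-I4 : ∀ w x y z → false ≡ tri w x y → false ≡ tri w x z → false ≡ tri w y z → false ≡ tri x y z → ⊥
tri-I4 = toWitness {a? = Fin.all? λ w → Fin.all? λ x → Fin.all? λ y → Fin.all? λ z →
  (false Bool.≟ tri w x y) →-dec (false Bool.≟ tri w x z) →-dec
  (false Bool.≟ tri w y z) →-dec (false Bool.≟ tri x y z) →-dec no id} tt

tri-H4 : ∀ v w x y z → true ≡ tri v w x → true ≡ tri v w y → true ≡ tri w x y → true ≡ tri v x z →
  false ≡ tri v x y → false ≡ tri v w z → false ≡ tri v y z → false ≡ tri w x z → false ≡ tri w y z →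
  false ≡ tri x y z → ⊥
tri-H4 = toWitness {a? = Fin.all? λ v → Fin.all? λ w → Fin.all? λ x → Fin.all? λ y → Fin.all? λ z →
  (true Bool.≟ tri v w x) →-dec (true Bool.≟ tri v w y) →-dec (true Bool.≟ tri w x y) →-dec
  (true Bool.≟ tri v x z) →-dec (false Bool.≟ tri v x y) →-dec (false Bool.≟ tri v w z) →-dec
  (false Bool.≟ tri v y z) →-dec (false Bool.≟ tri w x z) →-dec (false Bool.≟ tri w y z) →-dec
  (false Bool.≟ tri x y z) →-dec no id} tt

colour : ℕ → Fin 3
colour 0 = 0F
colour 1 = 1F
colour 2 = 2F
colour (suc (suc (suc n))) = colour n

turan : ∀ n → ThreeGraph n
turan n = record
  { edge  = λ a b c → tri (colour (Fin.toℕ a)) (colour (Fin.toℕ b)) (colour (Fin.toℕ c))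
  ; sym₁₂ = λ a b c → tri-sym₁₂ (colour (Fin.toℕ a)) (colour (Fin.toℕ b)) (colour (Fin.toℕ c))
  ; sym₂₃ = λ a b c → tri-sym₂₃ (colour (Fin.toℕ a)) (colour (Fin.toℕ b)) (colour (Fin.toℕ c))
  }

turan-free : ∀ n → Free (turan n)
turan-free n =
    (λ (f , _ , e) → tri-I4 (c f 0F) (c f 1F) (c f 2F) (c f 3F) (e 0F 1F 2F (λ ()) (λ ()) (λ ())) (e 0F 1F 3F (λ ()) (λ ()) (λ ()))
      (e 0F 2F 3F (λ ()) (λ ()) (λ ())) (e 1F 2F 3F (λ ()) (λ ()) (λ ())))
  , (λ (f , _ , e) → tri-H4 (c f 0F) (c f 1F) (c f 2F) (c f 3F) (c f 4F)
      (e 0F 1F 2F (λ ()) (λ ()) (λ ())) (e 0F 1F 3F (λ ()) (λ ()) (λ ())) (e 1F 2F 3F (λ ()) (λ ()) (λ ()))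
      (e 0F 2F 4F (λ ()) (λ ()) (λ ())) (e 0F 2F 3F (λ ()) (λ ()) (λ ())) (e 0F 1F 4F (λ ()) (λ ()) (λ ()))
      (e 0F 3F 4F (λ ()) (λ ()) (λ ())) (e 1F 2F 4F (λ ()) (λ ()) (λ ())) (e 1F 3F 4F (λ ()) (λ ()) (λ ()))
      (e 2F 3F 4F (λ ()) (λ ()) (λ ())))
  where
  c : ∀ {k} → (Fin k → Fin n) → Fin k → Fin 3
  c f i = colour (Fin.toℕ (f i))

-- Among the first `n` numbers, at most 3q of them, each residue modulo 3 occurs at most `q` times.
colour-sum : ∀ q n → n ℕ.≤ q ℕ.* 3 → (g : Fin 3 → ℕ) →
  ∑ℕ.sum (λ (i : Fin n) → g (colour (Fin.toℕ i))) ℕ.≤ q ℕ.* ∑ℕ.sum g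
colour-sum q       0 h g = ℕ.z≤n
colour-sum (suc q) 1 h g = ℕ.≤-trans (ℕ.+-monoʳ-≤ (g 0F) ℕ.z≤n) (ℕ.m≤m+n _ _)
colour-sum (suc q) 2 h g = ℕ.≤-trans (ℕ.+-monoʳ-≤ (g 0F) (ℕ.+-monoʳ-≤ (g 1F) ℕ.z≤n)) (ℕ.m≤m+n _ _)
colour-sum (suc q) (suc (suc (suc n))) (ℕ.s≤s (ℕ.s≤s (ℕ.s≤s h))) g = ℕ.≤-trans
  (ℕ.+-monoʳ-≤ (g 0F) (ℕ.+-monoʳ-≤ (g 1F) (ℕ.+-monoʳ-≤ (g 2F) (colour-sum q n h g))))
  (ℕ.≤-reflexive (solve 4 (λ x y z w → x :+ (y :+ (z :+ w)) := x :+ (y :+ (z :+ con 0)) :+ w) refl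
    (g 0F) (g 1F) (g 2F) (q ℕ.* ∑ℕ.sum g)))
  where open +-*-Solver

turan-edges : ∀ q n → n ℕ.≤ q ℕ.* 3 → 6 ℕ.* numEdges (turan n) ℕ.≤ 12 ℕ.* (q ℕ.* (q ℕ.* q))
turan-edges q n h = begin
  6 ℕ.* numEdges (turan n)
    ≡⟨ ∑-orders ⟨
  ∑³ orders
    ≤⟨ ∑³-mono orders≤edge ⟩
  (∑ℕ.sum λ a → ∑ℕ.sum λ b → ∑ℕ.sum λ c → ind (tri (col a) (col b) (col c)))
    ≤⟨ (∑-mono λ a → ∑-mono λ b → colour-sum q n h (λ z → ind (tri (col a) (col b) z))) ⟩
  (∑ℕ.sum λ a → ∑ℕ.sum λ b → q ℕ.* ∑ℕ.sum (λ z → ind (tri (col a) (col b) z)))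
    ≤⟨ (∑-mono λ a → colour-sum q n h (λ y → q ℕ.* ∑ℕ.sum (λ z → ind (tri (col a) y z)))) ⟩
  (∑ℕ.sum λ a → q ℕ.* ∑ℕ.sum (λ y → q ℕ.* ∑ℕ.sum (λ z → ind (tri (col a) y z))))
    ≤⟨ colour-sum q n h (λ x → q ℕ.* ∑ℕ.sum (λ y → q ℕ.* ∑ℕ.sum (λ z → ind (tri x y z)))) ⟩
  q ℕ.* ∑ℕ.sum (λ x → q ℕ.* ∑ℕ.sum (λ y → q ℕ.* ∑ℕ.sum (λ z → ind (tri x y z))))
    -- Two vertices of equal colour are completed to an edge by two colours, two of different
    -- colours by one: 12 of the 27 ordered colour triples, which is the density 4/9.
    ≡⟨ solve 1 (λ q → let r = λ i j k → q :* (q :* con i :+ (q :* con j :+ (q :* con k :+ con 0))) in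
         q :* (r 2 1 1 :+ (r 1 2 1 :+ (r 1 1 2 :+ con 0))) := con 12 :* (q :* (q :* q))) refl q ⟩
  12 ℕ.* (q ℕ.* (q ℕ.* q)) ∎
  where
  open ℕ.≤-Reasoning
  open +-*-Solver
  open EdgeCount (turan n)
  col : Fin n → Fin 3
  col a = colour (Fin.toℕ a)

-- The witness is ⌊n/3⌋ + 1; rounding up affects only lower order terms.
third : ∀ n → ∃ λ q → n ℕ.≤ q ℕ.* 3 × q ℕ.* 3 ℕ.≤ n ℕ.+ 3
third 0 = 1 , ℕ.z≤n , ℕ.≤-refl
third 1 = 1 , ℕ.s≤s ℕ.z≤n , ℕ.m≤n+m 3 1
third 2 = 1 , ℕ.s≤s (ℕ.s≤s ℕ.z≤n) , ℕ.m≤n+m 3 2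
third (suc (suc (suc n))) = let q , h , k = third n in suc q , ℕ.+-monoʳ-≤ 3 h , ℕ.+-monoʳ-≤ 3 k

upperBound : ∀ n → 54 ℕ.* numEdges (turan n) ℕ.≤ 4 ℕ.* ((n ℕ.+ 3) ℕ.* ((n ℕ.+ 3) ℕ.* (n ℕ.+ 3)))
upperBound n with third n
... | q , h , k = begin
  54 ℕ.* numEdges (turan n)          ≡⟨ ℕ.*-assoc 9 6 (numEdges (turan n)) ⟩
  9 ℕ.* (6 ℕ.* numEdges (turan n))   ≤⟨ ℕ.*-monoʳ-≤ 9 (turan-edges q n h) ⟩
  9 ℕ.* (12 ℕ.* (q ℕ.* (q ℕ.* q)))
    ≡⟨ solve 1 (λ q → con 9 :* (con 12 :* (q :* (q :* q))) := con 4 :* (q :* con 3 :* (q :* con 3 :* (q :* con 3)))) refl q ⟩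
  4 ℕ.* (q ℕ.* 3 ℕ.* (q ℕ.* 3 ℕ.* (q ℕ.* 3)))
    ≤⟨ ℕ.*-monoʳ-≤ 4 (ℕ.*-mono-≤ k (ℕ.*-mono-≤ k k)) ⟩
  4 ℕ.* ((n ℕ.+ 3) ℕ.* ((n ℕ.+ 3) ℕ.* (n ℕ.+ 3))) ∎
  where
  open ℕ.≤-Reasoning
  open +-*-Solver

-- Binomial coefficients as polynomials

nC2 : ∀ n → n ℕ.* n ≡ 2 ℕ.* (n C 2) ℕ.+ n
nC2 zero    = refl
nC2 (suc n) = begin
  suc n ℕ.* suc n
    ≡⟨ solve 1 (λ n → (con 1 :+ n) :* (con 1 :+ n) := n :* n :+ (n :+ (con 1 :+ n))) refl n ⟩
  n ℕ.* n ℕ.+ (n ℕ.+ suc n)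
    ≡⟨ cong (ℕ._+ (n ℕ.+ suc n)) (nC2 n) ⟩
  2 ℕ.* (n C 2) ℕ.+ n ℕ.+ (n ℕ.+ suc n)
    ≡⟨ solve 2 (λ n x → con 2 :* x :+ n :+ (n :+ (con 1 :+ n)) := con 2 :* (n :+ x) :+ (con 1 :+ n)) refl n (n C 2) ⟩
  2 ℕ.* (n ℕ.+ n C 2) ℕ.+ suc n
    ≡⟨ cong (λ x → 2 ℕ.* (x ℕ.+ n C 2) ℕ.+ suc n) (nC1≡n n) ⟨
  2 ℕ.* (n C 1 ℕ.+ n C 2) ℕ.+ suc n
    ≡⟨ cong (λ x → 2 ℕ.* x ℕ.+ suc n) (nCk+nC[k+1]≡[n+1]C[k+1] n 1) ⟩
  2 ℕ.* (suc n C 2) ℕ.+ suc n ∎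
  where
  open ≡-Reasoning
  open +-*-Solver

-- The expansion of n(n - 1)(n - 2) = 6 C(n, 3), arranged without subtraction.
nC3 : ∀ n → n ℕ.* (n ℕ.* n) ℕ.+ 2 ℕ.* n ≡ 6 ℕ.* (n C 3) ℕ.+ 3 ℕ.* (n ℕ.* n)
nC3 zero    = refl
nC3 (suc n) = begin
  suc n ℕ.* (suc n ℕ.* suc n) ℕ.+ 2 ℕ.* suc n
    ≡⟨ solve 1 (λ n → (con 1 :+ n) :* ((con 1 :+ n) :* (con 1 :+ n)) :+ con 2 :* (con 1 :+ n)
         := n :* (n :* n) :+ con 2 :* n :+ (con 3 :* (n :* n) :+ (con 3 :* n :+ con 3))) refl n ⟩
  n ℕ.* (n ℕ.* n) ℕ.+ 2 ℕ.* n ℕ.+ (3 ℕ.* (n ℕ.* n) ℕ.+ (3 ℕ.* n ℕ.+ 3))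
    ≡⟨ cong₂ (λ x y → x ℕ.+ (3 ℕ.* y ℕ.+ (3 ℕ.* n ℕ.+ 3))) (nC3 n) (nC2 n) ⟩
  6 ℕ.* (n C 3) ℕ.+ 3 ℕ.* (n ℕ.* n) ℕ.+ (3 ℕ.* (2 ℕ.* (n C 2) ℕ.+ n) ℕ.+ (3 ℕ.* n ℕ.+ 3))
    ≡⟨ solve 3 (λ n x y → con 6 :* x :+ con 3 :* (n :* n) :+ (con 3 :* (con 2 :* y :+ n) :+ (con 3 :* n :+ con 3))
         := con 6 :* (y :+ x) :+ con 3 :* ((con 1 :+ n) :* (con 1 :+ n))) refl n (n C 3) (n C 2) ⟩
  6 ℕ.* (n C 2 ℕ.+ n C 3) ℕ.+ 3 ℕ.* (suc n ℕ.* suc n)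
    ≡⟨ cong (λ x → 6 ℕ.* x ℕ.+ 3 ℕ.* (suc n ℕ.* suc n)) (nCk+nC[k+1]≡[n+1]C[k+1] n 2) ⟩
  6 ℕ.* (suc n C 3) ℕ.+ 3 ℕ.* (suc n ℕ.* suc n) ∎
  where
  open ≡-Reasoning
  open +-*-Solver

-- Passing to the limit

module Asymptotics (n m c D : ℕ) (nonempty : 1 ℕ.≤ n)
  (lower : 4 ℕ.* (n ℕ.* (n ℕ.* n)) ℕ.≤ 9 ℕ.* (6 ℕ.* m ℕ.+ 3 ℕ.* (n ℕ.* n)))
  (upper : 54 ℕ.* m ℕ.≤ 4 ℕ.* ((n ℕ.+ 3) ℕ.* ((n ℕ.+ 3) ℕ.* (n ℕ.+ 3))))
  (binomial : n ℕ.* (n ℕ.* n) ℕ.+ 2 ℕ.* n ≡ 6 ℕ.* c ℕ.+ 3 ℕ.* (n ℕ.* n))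
  (large : 30 ℕ.* D ℕ.+ 4 ℕ.≤ n) where

  open ℕ.≤-Reasoning
  open +-*-Solver

  private
    s t : ℕ
    s = n ℕ.* n
    t = n ℕ.* s

    n≤s : n ℕ.≤ s
    n≤s = ℕ.≤-trans (ℕ.≤-reflexive (sym (ℕ.*-identityʳ n))) (ℕ.*-monoʳ-≤ n nonempty)

    1≤s : 1 ℕ.≤ s
    1≤s = ℕ.≤-trans nonempty n≤s

  -- The constant 44 serves this bound and `below` alike: here the lower order terms amount to 256
  -- s, which is at most 6 · 44 s, there only to 35 s.
  above : 9 ℕ.* m ℕ.≤ 4 ℕ.* c ℕ.+ 44 ℕ.* s
  above = ℕ.*-cancelˡ-≤ 6 (ℕ.+-cancelʳ-≤ (12 ℕ.* s) (6 ℕ.* (9 ℕ.* m)) (6 ℕ.* (4 ℕ.* c ℕ.+ 44 ℕ.* s)) (begin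
    6 ℕ.* (9 ℕ.* m) ℕ.+ 12 ℕ.* s
      ≡⟨ cong (ℕ._+ 12 ℕ.* s) (ℕ.*-assoc 6 9 m) ⟨
    54 ℕ.* m ℕ.+ 12 ℕ.* s
      ≤⟨ ℕ.+-monoˡ-≤ (12 ℕ.* s) upper ⟩
    4 ℕ.* ((n ℕ.+ 3) ℕ.* ((n ℕ.+ 3) ℕ.* (n ℕ.+ 3))) ℕ.+ 12 ℕ.* s
      ≡⟨ solve 1 (λ n → con 4 :* ((n :+ con 3) :* ((n :+ con 3) :* (n :+ con 3))) :+ con 12 :* (n :* n)
           := con 4 :* (n :* (n :* n)) :+ con 8 :* n :+ (con 48 :* (n :* n) :+ con 100 :* n :+ con 108 :* con 1)) refl n ⟩
    4 ℕ.* t ℕ.+ 8 ℕ.* n ℕ.+ (48 ℕ.* s ℕ.+ 100 ℕ.* n ℕ.+ 108 ℕ.* 1)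
      ≤⟨ ℕ.+-monoʳ-≤ (4 ℕ.* t ℕ.+ 8 ℕ.* n) (ℕ.+-mono-≤ (ℕ.+-monoʳ-≤ (48 ℕ.* s) (ℕ.*-monoʳ-≤ 100 n≤s)) (ℕ.*-monoʳ-≤ 108 1≤s)) ⟩
    4 ℕ.* t ℕ.+ 8 ℕ.* n ℕ.+ (48 ℕ.* s ℕ.+ 100 ℕ.* s ℕ.+ 108 ℕ.* s)
      ≡⟨ solve 3 (λ n s t → con 4 :* t :+ con 8 :* n :+ (con 48 :* s :+ con 100 :* s :+ con 108 :* s)
           := con 4 :* (t :+ con 2 :* n) :+ con 256 :* s) refl n s t ⟩
    4 ℕ.* (t ℕ.+ 2 ℕ.* n) ℕ.+ 256 ℕ.* s
      ≡⟨ cong (λ x → 4 ℕ.* x ℕ.+ 256 ℕ.* s) binomial ⟩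
    4 ℕ.* (6 ℕ.* c ℕ.+ 3 ℕ.* s) ℕ.+ 256 ℕ.* s
      ≤⟨ ℕ.m≤m+n _ (8 ℕ.* s) ⟩
    4 ℕ.* (6 ℕ.* c ℕ.+ 3 ℕ.* s) ℕ.+ 256 ℕ.* s ℕ.+ 8 ℕ.* s
      ≡⟨ solve 2 (λ c s → con 4 :* (con 6 :* c :+ con 3 :* s) :+ con 256 :* s :+ con 8 :* s
           := con 6 :* (con 4 :* c :+ con 44 :* s) :+ con 12 :* s) refl c s ⟩
    6 ℕ.* (4 ℕ.* c ℕ.+ 44 ℕ.* s) ℕ.+ 12 ℕ.* s ∎))

  below : 4 ℕ.* c ℕ.≤ 9 ℕ.* m ℕ.+ 44 ℕ.* s
  below = ℕ.*-cancelˡ-≤ 6 (begin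
    6 ℕ.* (4 ℕ.* c)
      ≤⟨ ℕ.m≤m+n _ (12 ℕ.* s) ⟩
    6 ℕ.* (4 ℕ.* c) ℕ.+ 12 ℕ.* s
      ≡⟨ solve 2 (λ c s → con 6 :* (con 4 :* c) :+ con 12 :* s := con 4 :* (con 6 :* c :+ con 3 :* s)) refl c s ⟩
    4 ℕ.* (6 ℕ.* c ℕ.+ 3 ℕ.* s)
      ≡⟨ cong (4 ℕ.*_) binomial ⟨
    4 ℕ.* (t ℕ.+ 2 ℕ.* n)
      ≡⟨ solve 2 (λ t n → con 4 :* (t :+ con 2 :* n) := con 4 :* t :+ con 8 :* n) refl t n ⟩
    4 ℕ.* t ℕ.+ 8 ℕ.* n
      ≤⟨ ℕ.+-mono-≤ lower (ℕ.*-monoʳ-≤ 8 n≤s) ⟩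
    9 ℕ.* (6 ℕ.* m ℕ.+ 3 ℕ.* s) ℕ.+ 8 ℕ.* s
      ≤⟨ ℕ.m≤m+n _ (229 ℕ.* s) ⟩
    9 ℕ.* (6 ℕ.* m ℕ.+ 3 ℕ.* s) ℕ.+ 8 ℕ.* s ℕ.+ 229 ℕ.* s
      ≡⟨ solve 2 (λ m s → con 9 :* (con 6 :* m :+ con 3 :* s) :+ con 8 :* s :+ con 229 :* s
           := con 6 :* (con 9 :* m :+ con 44 :* s)) refl m s ⟩
    6 ℕ.* (9 ℕ.* m ℕ.+ 44 ℕ.* s) ∎)

  -- The threshold 30 D + 4 originates here. Since 18 C(n, 3) is at least 3n³ - 9n², it suffices
  -- that 88 D n² + 9n² stays below 3n³, and 3 · 30 exceeds 88 while 3 · 4 exceeds 9.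
  negligible : 44 ℕ.* s ℕ.* D ℕ.< 9 ℕ.* c
  negligible = ℕ.*-cancelˡ-< 2 _ _ (ℕ.+-cancelʳ-< (9 ℕ.* s) _ _ (begin-strict
    2 ℕ.* (44 ℕ.* s ℕ.* D) ℕ.+ 9 ℕ.* s
      <⟨ ℕ.+-monoʳ-< (2 ℕ.* (44 ℕ.* s ℕ.* D)) (ℕ.*-monoˡ-< s {{ℕ.>-nonZero 1≤s}} {9} {12} (ℕ.m≤m+n 10 2)) ⟩
    2 ℕ.* (44 ℕ.* s ℕ.* D) ℕ.+ 12 ℕ.* s
      ≤⟨ ℕ.m≤m+n _ (2 ℕ.* s ℕ.* D) ⟩
    2 ℕ.* (44 ℕ.* s ℕ.* D) ℕ.+ 12 ℕ.* s ℕ.+ 2 ℕ.* s ℕ.* D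
      ≡⟨ solve 2 (λ s D → con 2 :* (con 44 :* s :* D) :+ con 12 :* s :+ con 2 :* s :* D
           := con 3 :* ((con 30 :* D :+ con 4) :* s)) refl s D ⟩
    3 ℕ.* ((30 ℕ.* D ℕ.+ 4) ℕ.* s)
      ≤⟨ ℕ.*-monoʳ-≤ 3 (ℕ.*-monoˡ-≤ s large) ⟩
    3 ℕ.* t
      ≤⟨ ℕ.*-monoʳ-≤ 3 (ℕ.m≤m+n t (2 ℕ.* n)) ⟩
    3 ℕ.* (t ℕ.+ 2 ℕ.* n)
      ≡⟨ cong (3 ℕ.*_) binomial ⟩
    3 ℕ.* (6 ℕ.* c ℕ.+ 3 ℕ.* s)
      ≡⟨ solve 2 (λ c s → con 3 :* (con 6 :* c :+ con 3 :* s) := con 2 :* (con 9 :* c) :+ con 9 :* s) refl c s ⟩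
    2 ℕ.* (9 ℕ.* c) ℕ.+ 9 ℕ.* s ∎))

  module _ (P : ℕ) .{{_ : ℕ.NonZero P}} where

    density-above : m ℕ.* (D ℕ.* 9) ℕ.< (P ℕ.* 9 ℕ.+ 4 ℕ.* D) ℕ.* c
    density-above = begin-strict
      m ℕ.* (D ℕ.* 9)
        ≡⟨ solve 2 (λ m D → m :* (D :* con 9) := con 9 :* m :* D) refl m D ⟩
      9 ℕ.* m ℕ.* D
        ≤⟨ ℕ.*-monoˡ-≤ D above ⟩
      (4 ℕ.* c ℕ.+ 44 ℕ.* s) ℕ.* D
        ≡⟨ solve 3 (λ c s D → (con 4 :* c :+ con 44 :* s) :* D := con 44 :* s :* D :+ con 4 :* D :* c) refl c s D ⟩
      44 ℕ.* s ℕ.* D ℕ.+ 4 ℕ.* D ℕ.* c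
        <⟨ ℕ.+-monoˡ-< (4 ℕ.* D ℕ.* c) negligible ⟩
      9 ℕ.* c ℕ.+ 4 ℕ.* D ℕ.* c
        ≤⟨ ℕ.+-monoˡ-≤ (4 ℕ.* D ℕ.* c) (ℕ.m≤n*m (9 ℕ.* c) P) ⟩
      P ℕ.* (9 ℕ.* c) ℕ.+ 4 ℕ.* D ℕ.* c
        ≡⟨ solve 3 (λ P c D → P :* (con 9 :* c) :+ con 4 :* D :* c := (P :* con 9 :+ con 4 :* D) :* c) refl P c D ⟩
      (P ℕ.* 9 ℕ.+ 4 ℕ.* D) ℕ.* c ∎

    density-below : 4 ℕ.* (D ℕ.* c) ℕ.< (P ℕ.* c ℕ.+ m ℕ.* D) ℕ.* 9
    density-below = begin-strict
      4 ℕ.* (D ℕ.* c)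
        ≡⟨ solve 2 (λ c D → con 4 :* (D :* c) := con 4 :* c :* D) refl c D ⟩
      4 ℕ.* c ℕ.* D
        ≤⟨ ℕ.*-monoˡ-≤ D below ⟩
      (9 ℕ.* m ℕ.+ 44 ℕ.* s) ℕ.* D
        ≡⟨ solve 3 (λ m s D → (con 9 :* m :+ con 44 :* s) :* D := con 44 :* s :* D :+ con 9 :* m :* D) refl m s D ⟩
      44 ℕ.* s ℕ.* D ℕ.+ 9 ℕ.* m ℕ.* D
        <⟨ ℕ.+-monoˡ-< (9 ℕ.* m ℕ.* D) negligible ⟩
      9 ℕ.* c ℕ.+ 9 ℕ.* m ℕ.* D
        ≤⟨ ℕ.+-monoˡ-≤ (9 ℕ.* m ℕ.* D) (ℕ.m≤n*m (9 ℕ.* c) P) ⟩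
      P ℕ.* (9 ℕ.* c) ℕ.+ 9 ℕ.* m ℕ.* D
        ≡⟨ solve 4 (λ P c m D → P :* (con 9 :* c) :+ con 9 :* m :* D := (P :* c :+ m :* D) :* con 9) refl P c m D ⟩
      (P ℕ.* c ℕ.+ m ℕ.* D) ℕ.* 9 ∎

fraction-< : ∀ a b P d e f → a ℕ.* (suc d ℕ.* suc f) ℕ.< (P ℕ.* suc f ℕ.+ e ℕ.* suc d) ℕ.* suc b →
  mkℚᵘ (+ a) b ℚᵘ.< mkℚᵘ (+ P) d ℚᵘ.+ mkℚᵘ (+ e) f
fraction-< a b P d e f h = ℚᵘ.*<* (subst₂ ℤ._<_ (ℤ.pos-* a (suc d ℕ.* suc f))
  (trans (ℤ.pos-* (P ℕ.* suc f ℕ.+ e ℕ.* suc d) (suc b))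
    (cong (ℤ._* + suc b) (cong₂ ℤ._+_ (ℤ.pos-* P (suc f)) (ℤ.pos-* e (suc d)))))
  (ℤ.+<+ h))

difference-< : ∀ ε u v → u ℚᵘ.< toℚᵘ ε ℚᵘ.+ v → fromℚᵘ u - fromℚᵘ v < ε
difference-< ε u v h = subst (fromℚᵘ u - fromℚᵘ v <_) cancel (ℚ.+-monoˡ-< (ℚ.- fromℚᵘ v) below)
  where
  below : fromℚᵘ u < ε ℚ.+ fromℚᵘ v
  below = ℚ.toℚᵘ-cancel-< (ℚᵘ.<-respˡ-≃ (ℚᵘ.≃-sym (ℚ.toℚᵘ-fromℚᵘ u)) (ℚᵘ.<-respʳ-≃ (ℚᵘ.≃-sym
    (ℚᵘ.≃-trans (ℚ.toℚᵘ-homo-+ ε (fromℚᵘ v)) (ℚᵘ.+-congʳ (toℚᵘ ε) (ℚ.toℚᵘ-fromℚᵘ v)))) h))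
  cancel : ε ℚ.+ fromℚᵘ v ℚ.+ ℚ.- fromℚᵘ v ≡ ε
  cancel = trans (ℚ.+-assoc ε (fromℚᵘ v) (ℚ.- fromℚᵘ v))
    (trans (cong (ε ℚ.+_) (ℚ.+-inverseʳ (fromℚᵘ v))) (ℚ.+-identityʳ ε))

distance-< : ∀ {ε} x y → x - y < ε → y - x < ε → ∣ x - y ∣ < ε
distance-< {ε} x y h k with ℚ.∣p∣≡p∨∣p∣≡-p (x - y)
... | inj₁ e = subst (_< ε) (sym e) h
... | inj₂ e = subst (_< ε) (sym (trans e negate)) k
  where
  negate : ℚ.- (x - y) ≡ y - x
  negate = ⁻¹-anti-homo‿- x y
    where open AbelianGroupProperties ℚ.+-0-abelianGroup

module _
  (v₅ : List (Fin 5)) (v₅≡ : v₅ ≡ allFin 5) (v₆ : List (Fin 6)) (v₆≡ : v₆ ≡ allFin 6)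
  (extension-bounded : ∀ s l → ExtensionBounded s l v₅ v₆) (hasRep-holds : ∀ s → HasRep s v₅) where

  density-limit : ∀ (ε : ℚ) → 0ℚ < ε → Σ ℕ λ N → ∀ (n m : ℕ) → n ≥ N → IsExMin n m →
    ∣ density n m - (+ 4) / 9 ∣ < ε
  density-limit (mkℚ (+ 0)      d _) (ℚ.*<* (ℤ.+<+ ()))
  density-limit (mkℚ -[1+ _ ]   d _) (ℚ.*<* ())
  -- `ε` is at least 1 / (d + 1), so the threshold depends only on the denominator.
  density-limit ε@(mkℚ (+ suc p) d _) _ = 30 ℕ.* suc d ℕ.+ 4 , close
    where
    close : ∀ n m → n ≥ 30 ℕ.* suc d ℕ.+ 4 → IsExMin n m → ∣ density n m - (+ 4) / 9 ∣ < ε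
    close n m large ((G , free , edges≡) , minimal) = byBinomial (n C 3) refl
      where
      -- The lower bound is applied to a graph with exactly `m` edges; the upper bound compares `m`
      -- with `turan n` by minimality.
      module A (c : ℕ) (c≡ : n C 3 ≡ c) = Asymptotics n m c (suc d)
        (ℕ.≤-trans (ℕ.≤-trans (ℕ.s≤s ℕ.z≤n) (ℕ.m≤n+m 4 (30 ℕ.* suc d))) large)
        (subst (λ e → 4 ℕ.* (n ℕ.* (n ℕ.* n)) ℕ.≤ 9 ℕ.* (6 ℕ.* e ℕ.+ 3 ℕ.* (n ℕ.* n))) edges≡
          (LowerBound.lowerBound v₅ v₅≡ v₆ v₆≡ extension-bounded hasRep-holds G free))
        (ℕ.≤-trans (ℕ.*-monoʳ-≤ 54 (minimal (turan n) (turan-free n))) (upperBound n))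
        (subst (λ c → n ℕ.* (n ℕ.* n) ℕ.+ 2 ℕ.* n ≡ 6 ℕ.* c ℕ.+ 3 ℕ.* (n ℕ.* n)) c≡ (nC3 n)) large

      density≡ : ∀ c → n C 3 ≡ suc c → density n m ≡ fromℚᵘ (mkℚᵘ (+ m) c)
      density≡ c e with n C 3 | e
      ... | suc _ | refl = refl

      byBinomial : ∀ c → n C 3 ≡ c → ∣ density n m - (+ 4) / 9 ∣ < ε
      -- `negligible` excludes a vanishing binomial coefficient, so the default value of `density`
      -- is never met.
      byBinomial zero    e = contradiction (A.negligible 0 e) λ ()
      byBinomial (suc c) e rewrite density≡ c e = distance-< (fromℚᵘ (mkℚᵘ (+ m) c)) ((+ 4) / 9)
        (difference-< ε (mkℚᵘ (+ m) c) (mkℚᵘ (+ 4) 8) (fraction-< m c (suc p) d 4 8 (A.density-above (suc c) e (suc p))))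
        (difference-< ε (mkℚᵘ (+ 4) 8) (mkℚᵘ (+ m) c) (fraction-< 4 8 (suc p) d m c (A.density-below (suc c) e (suc p))))

-- The certificate is evaluated here: of the 2^10 labelled graphs on five vertices, the 22 listed in
-- `reps` are extended in 2^10 ways each.
all-repOK : ∀ s → repOK s ≡ true
all-repOK = all3-sound 5 repOK refl

-- Evaluation over the same 2^10 graphs shows that `reps` is complete: each admissible graph has a
-- listed rearrangement.
all-hasRep : ∀ s → hasRep s ≡ true
all-hasRep = all3-sound 5 hasRep refl

theorem4p1 : ∀ (ε : ℚ) → 0ℚ < ε →
    Σ ℕ λ N → ∀ (n m : ℕ) → n ≥ N → IsExMin n m →
    ∣ density n m - (+ 4) / 9 ∣ < ε
theorem4p1 = density-limit (allFin 5) refl (allFin 6) refl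
  (λ s → repOK-sound s (all-repOK s)) (λ s → hasRep-sound s (all-hasRep s))
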